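{- For each $n>1$ and each common type $\mathcal{T}_1$ of nondeterministic $\omega$-automata, there exists a $\mathcal{T}_1$ automaton $\mathcal{A}_n$ with $n$ states, over an alphabet whose size is bounded by a constant independent of $n$, such that: (i) for each common type $\mathcal{T}_2$, every $\mathcal{T}_2$ automaton that accepts the complement of $\mathcal{L}(\mathcal{A}_n)$ has at least $L(n)$ states; (ii) for each common type $\mathcal{T}_2$ other than Büchi and generalized Büchi, every deterministic $\mathcal{T}_2$ automaton that accepts $\mathcal{L}(\mathcal{A}_n)$ has at least $L(n)$ states.
   Context: An $\omega$-automaton is $(\Sigma,S,I,\Delta,Acc)$ with finite alphabet, finite states, $I\subseteq S$, $\Delta\subseteq S\times\Sigma\times S$. A run over $\alpha\in\Sigma^\omega$ is $\rho(0)\rho(1)\cdots$ with $\rho(0)\in I$ and $\langle\rho(i),\alpha(i),\rho(i+1)\rangle\in\Delta$; $Inf(\rho)$ is the set of states occurring infinitely often; $\alpha$ is accepted if some run is successful; the automaton is deterministic if $|I|=1$ and for each $p,a$ there is at most one $q$ with $\langle p,a,q\rangle\in\Delta$. The common types: Büchi ($Acc=F\subseteq S$, successful iff $Inf(\rho)\cap F\ne\emptyset$); generalized Büchi ($Acc=\{F_1,\dots,F_k\}$, iff $Inf(\rho)\cap F_i\ne\emptyset$ for all $i$); Rabin ($Acc=\{\langle G_i,B_i\rangle\}_{i\le k}$, iff for some $i$, $Inf(\rho)\cap G_i\ne\emptyset$ and $Inf(\rho)\cap B_i=\emptyset$); Streett (same form, iff for all $i$, $Inf(\rho)\cap B_i\ne\emptyset$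 implies $Inf(\rho)\cap G_i\ne\emptyset$); Muller ($Acc=\mathcal{F}\subseteq\mathcal{P}(S)$, iff $Inf(\rho)\in\mathcal{F}$); parity ($Acc=c:S\to\{0,\dots,l\}$, iff $\min\{c(q):q\in Inf(\rho)\}$ is even). For $n>1$ let $S'_n$ be a set of $n-1$ elements; for $1\le m<n$, a $Q(m)$-ranking is a function $h:S'_n\to\{0,\dots,2m-1\}$ attaining every odd value $1,3,\dots,2m-1$; $L(n,m)$ is their number and $L(n)=\max_{1\le m<n}L(n,m)$. -}

module Defs where

open import Data.Nat using (ℕ; zero; suc; _+_; _*_; _∸_; _≤_; _⊔_)
open import Data.Nat.Properties using ()
open import Data.Bool using (Bool; true; false; _∧_)
open import Data.Fin using (Fin; toℕ)
open import Data.Fin.Subset using (Subset; _∈_)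
open import Data.Vec using (Vec; []; _∷_; toList)
open import Data.List using (List; []; _∷_; length; filterᵇ; map; concatMap; upTo; allFin; foldr)
open import Data.Bool.ListAction using (any; all)
open import Data.Empty using (⊥)
open import Data.Unit using (⊤)
open import Data.Product using (proj₁; proj₂)
open import Data.List.Membership.Propositional renaming (_∈_ to _∈ˡ_)
open import Data.Product using (Σ; ∃; _×_; _,_)
open import Relation.Binary.PropositionalEquality using (_≡_)
open import Relation.Nullary using (¬_)
open import Function.Bundles using (_⇔_)
open import Data.Nat.Base using (_≡ᵇ_)

data AccType : Set where
  buchi genBuchi rabin streett muller parity : AccType

NotBuchiLike : AccType → Set
NotBuchiLike buchi    = ⊥
NotBuchiLike genBuchi = ⊥
NotBuchiLike _        = ⊤

AccData : AccType → ℕ → Set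
AccData buchi    k = Subset k
AccData genBuchi k = List (Subset k)
AccData rabin    k = List (Subset k × Subset k)
AccData streett  k = List (Subset k × Subset k)
AccData muller   k = List (Subset k)
AccData parity   k = Fin k → ℕ

record Aut (T : AccType) (s : ℕ) : Set where
  field
    states : ℕ
    init   : Subset states
    delta  : Fin states → Fin s → Fin states → Bool
    acc    : AccData T states
open Aut public

Word : ℕ → Set
Word s = ℕ → Fin s

InfOcc : {k : ℕ} → (ℕ → Fin k) → Fin k → Set
InfOcc ρ q = ∀ i → ∃ λ j → i ≤ j × ρ j ≡ q

IsRun : {T : AccType} {s : ℕ} (A : Aut T s) → Word s → (ℕ → Fin (states A)) → Set
IsRun A α ρ = (ρ 0 ∈ init A) × (∀ i → delta A (ρ i) (α i) (ρ (suc i)) ≡ true)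

Meets : {k : ℕ} → (ℕ → Fin k) → Subset k → Set
Meets ρ F = ∃ λ q → InfOcc ρ q × q ∈ F

Successful : (T : AccType) {k : ℕ} → AccData T k → (ℕ → Fin k) → Set
Successful buchi    F  ρ = Meets ρ F
Successful genBuchi Fs ρ = ∀ F → F ∈ˡ Fs → Meets ρ F
Successful rabin    Ps ρ = ∃ λ GB → GB ∈ˡ Ps × (Meets ρ (proj₁ GB) × ¬ Meets ρ (proj₂ GB))
Successful streett  Ps ρ = ∀ GB → GB ∈ˡ Ps → Meets ρ (proj₂ GB) → Meets ρ (proj₁ GB)
Successful muller   𝓕 ρ = ∃ λ F → F ∈ˡ 𝓕 × (∀ q → InfOcc ρ q ⇔ q ∈ F)
Successful parity   c  ρ = ∃ λ q → InfOcc ρ q × Even (c q) × (∀ q' → InfOcc ρ q' → c q ≤ c q')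
  where
        Even : ℕ → Set
        Even m = ∃ λ h → m ≡ h + h

Accepts : {T : AccType} {s : ℕ} (A : Aut T s) → Word s → Set
Accepts {T} A α = ∃ λ ρ → IsRun A α ρ × Successful T (acc A) ρ

Deterministic : {T : AccType} {s : ℕ} → Aut T s → Set
Deterministic A =
  (∃ λ q₀ → q₀ ∈ init A × (∀ q → q ∈ init A → q ≡ q₀)) ×
  (∀ p a q q' → delta A p a q ≡ true → delta A p a q' ≡ true → q ≡ q')

allVecs : (a b : ℕ) → List (Vec (Fin b) a)
allVecs zero    b = [] ∷ []
allVecs (suc a) b = concatMap (λ x → map (x ∷_) (allVecs a b)) (allFin b)

isQRanking : (m : ℕ) {a : ℕ} → Vec (Fin (2 * m)) a → Bool
isQRanking m h = all (λ j → any (λ x → toℕ x ≡ᵇ (2 * j + 1)) (toList h)) (upTo m)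

-- L(n,m): number of Q(m)-rankings h : S'_n → {0,...,2m-1}, |S'_n| = n-1
Lnm : ℕ → ℕ → ℕ
Lnm n m = length (filterᵇ (isQRanking m) (allVecs (n ∸ 1) (2 * m)))

Ln : ℕ → ℕ
Ln n = foldr _⊔_ 0 (map (λ i → Lnm n (suc i)) (upTo (n ∸ 1)))

{-# OPTIONS --safe #-}
module Submission where

-- Threads of the automaton A carry the ranks of Q-rankings: a link from f to g is a word leading from p to q
-- through the final state if f p > g q, and avoiding it if f p = g q is odd; no path raises the rank. The word
-- that runs cyclically through all Q(m)-rankings is therefore rejected. If B has fewer states than there are
-- rankings, then in every cycle some state of B is seen both at a cut f and at a later cut g with f p > g p for
-- some p; repeating the segment between the two cuts does not change the recurring states of the run of B,
-- but gives a thread of A at an odd rank v, g p ≤ v ≤ f p, a visit to the final state. So A accepts the rearranged word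
-- while B cannot distinguish it.
--
-- The value v depends on the cycle, and that some v recurs is not provable, even up to double negation, without
-- Markov's principle. If it fails, there is a sequence β that is neither finite nor constructively infinite.
-- Inserting at the times β a recharge, which lifts threads to all ranks, keeps the word rejected; loops of B
-- through such recharges then let a thread change its level v, and a round robin schedule does so
-- rarely enough that the recurring states of B remain the same.

open import Defs
open import Data.Bool using (Bool; true; false; _∨_; _∧_; if_then_else_)
import Data.Bool as Bool
import Data.Bool.Properties as Bool
open import Data.Bool.Properties using (∨-assoc; ∨-identityʳ; ∨-zeroʳ; T-≡; T?)
open import Data.Empty using (⊥; ⊥-elim)
open import Data.Fin using (Fin; zero; suc; toℕ; inject₁; fromℕ; fromℕ<)
import Data.Fin as F
import Data.Fin.Properties as Fin
open import Data.Fin.Subset using (Subset; inside; outside; ⁅_⁆) renaming (⊥ to ∅; ⊤ to entire; _∈_ to _∈ˢ_)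
open import Data.Fin.Subset.Properties using (x∈⁅x⁆; x∈⁅y⁆⇒x≡y; ∉⊥; ∈⊤)
open import Data.List using (List; []; _∷_; _++_; length; lookup; map; concatMap; allFin; cartesianProduct; filterᵇ; upTo)
open import Data.List.Membership.Propositional using (_∈_)
open import Data.List.Membership.Propositional.Properties using
  (∈-allFin; ∈-cartesianProduct⁺; ∈-++⁺ˡ; ∈-++⁺ʳ; ∈-++⁻; ∈-map⁺; ∈-map⁻; ∈-upTo⁺; ∈-lookup)
open import Data.List.Properties using (++-assoc; length-++; length-map; foldr-preservesᵇ)
open import Data.List.Relation.Unary.All using (All; []; _∷_)
import Data.List.Relation.Unary.All as All
import Data.List.Relation.Unary.All.Properties as All
open import Data.List.Relation.Unary.AllPairs using (AllPairs; []; _∷_)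
import Data.List.Relation.Unary.AllPairs as AllPairs
import Data.List.Relation.Unary.AllPairs.Properties as AllPairs
open import Data.List.Relation.Unary.Any using (Any; here; there)
import Data.List.Relation.Unary.Any.Properties as Any
open import Data.Nat using (ℕ; zero; suc; _+_; _*_; _∸_; _⊔_; _/_; _%_; _≤_; _<_; z≤n; s≤s; z<s; s<s; _≤?_; _<?_; _≤ᵇ_; _<ᵇ_)
open import Data.Nat.Divisibility using (n∣m*n)
import Data.Nat.DivMod as ℕ
import Data.Nat.Properties as ℕ
open import Data.Product using (Σ; ∃; ∃₂; _×_; _,_; proj₁; proj₂)
open import Data.Sum using (_⊎_; inj₁; inj₂; [_,_]; [_,_]′)
open import Data.Unit using (⊤; tt)
open import Data.Vec using (Vec; []; _∷_; tabulate; toList)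
import Data.Vec as Vec
import Data.Vec.Properties as Vec
open import Effect.Monad using (RawMonad)
open import Function using (_∘_; id)
open import Function.Bundles using (_⇔_; mk⇔; Equivalence)
open import Relation.Binary.Definitions using (tri<; tri≈; tri>)
open import Relation.Binary.PropositionalEquality hiding ([_])
open import Relation.Nullary using (¬_; Dec; yes; no; does; contradiction)
open import Relation.Nullary.Decidable using (_×-dec_; _⊎-dec_; ¬?; dec-true; dec-false; ¬¬-excluded-middle)
open import Relation.Nullary.Negation using (¬¬-Monad)

-- Letters and paths of the hard automaton

-- Every acceptance condition of `B` depends only on the set of recurring states of the run. A
-- rearranged run with the same recurring states is therefore successful exactly if the original is,
-- and all types of `B` are handled at once. Parts (i) and (ii) differ only in how a word rejected
-- by `A` yields a run of `B` that cannot be rearranged into a run over a word accepted by `A`. A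
-- deterministic `B` might have no infinite run over such a word; recharges exclude this as well,
-- because every prefix of a test word extends to an accepted word by recharging in all later
-- blocks.
--
-- The alphabet stays constant because an operation on two arbitrary slots is conjugated by
-- rotations into one on two fixed slots. As `Ln` is a maximum over m, it suffices to fix m and to
-- bound each `Lnm`. That Q(m)-rankings attain all odd values below 2m is what lets links compose: a
-- path can always be relayed through a slot of a suitable odd rank, and a thread on an odd level
-- can be kept there forever.

private variable
  k : ℕ

-- The slots are the domain of the rankings for n = k + 3; the remaining state is the final one. The
-- operations need two distinct slots, which leaves n = 2 as a separate case.
Slot St : ℕ → Set
Slot k = Fin (suc (suc k))
St k = Fin (suc (suc (suc k)))

pattern slot p = suc p
pattern final = zero
pattern #0 = zero
pattern #1 = suc zero

-- The two-letter operations "drop" and "recharge" lead through the final state.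
data Letter : Set where
  idle rotate rotate⁻ turn turn⁻ kill copy swap dropIn dropOut chargeIn chargeOut : Letter

rot : ∀ {n} → Fin (suc n) → Fin (suc n)
rot zero    = fromℕ _
rot (suc p) = inject₁ p

rot-injective : ∀ {n} (p q : Fin (suc n)) → rot p ≡ rot q → p ≡ q
rot-injective zero    zero    _ = refl
rot-injective zero    (suc q) e = contradiction e Fin.fromℕ≢inject₁
rot-injective (suc p) zero    e = contradiction (sym e) Fin.fromℕ≢inject₁
rot-injective (suc p) (suc q) e = cong suc (Fin.inject₁-injective e)

-- Together with `rot` this brings any two distinct slots to `#0` and `#1`: `rot` moves the first
-- into place, then `trn` moves the second without disturbing it.
trn : Slot k → Slot k
trn zero    = zero
trn (suc p) = suc (rot p)

trn-injective : (p q : Slot k) → trn p ≡ trn q → p ≡ q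
trn-injective zero    zero    _ = refl
trn-injective (suc p) (suc q) e = cong suc (rot-injective p q (Fin.suc-injective e))

data Op : Set where
  kills copies drops swaps : Op

Act : Op → (x y p q : Slot k) → Bool → Set
Act kills  x y p q b = p ≡ q × p ≢ y × b ≡ false
Act copies x y p q b = (p ≡ q ⊎ (p ≡ x × q ≡ y)) × b ≡ false
Act drops  x y p q b = (p ≡ q × b ≡ false) ⊎ (p ≡ x × q ≡ y × b ≡ true)
Act swaps  x y p q b = ((p ≡ x × q ≡ y) ⊎ (p ≡ y × q ≡ x) ⊎ (p ≡ q × p ≢ x × p ≢ y)) × b ≡ false

Moves : Letter → Slot k → Slot k → Set
Moves idle      p q = p ≡ q
Moves rotate    p q = rot p ≡ q
Moves rotate⁻   p q = p ≡ rot q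
Moves turn      p q = trn p ≡ q
Moves turn⁻     p q = p ≡ trn q
Moves kill      p q = p ≡ q × p ≢ #1
Moves copy      p q = p ≡ q ⊎ (p ≡ #0 × q ≡ #1)
Moves swap      p q = (p ≡ #0 × q ≡ #1) ⊎ (p ≡ #1 × q ≡ #0) ⊎ (p ≡ q × p ≢ #0 × p ≢ #1)
Moves dropIn    p q = p ≡ q
Moves dropOut   p q = p ≡ q
Moves chargeIn  p q = ⊥
Moves chargeOut p q = ⊥

Enters Leaves : Letter → Slot k → Set
Enters dropIn   p = p ≡ #0
Enters chargeIn p = ⊤
Enters _        p = ⊥
Leaves dropOut   q = q ≡ #1
Leaves chargeOut q = ⊤
Leaves _         q = ⊥

Edge : Letter → St k → St k → Set
Edge a (slot p) (slot q) = Moves a p q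
Edge a (slot p) final    = Enters a p
Edge a final    (slot q) = Leaves a q
Edge a final    final    = ⊥

moves? : ∀ a (p q : Slot k) → Dec (Moves a p q)
moves? idle      p q = p Fin.≟ q
moves? rotate    p q = rot p Fin.≟ q
moves? rotate⁻   p q = p Fin.≟ rot q
moves? turn      p q = trn p Fin.≟ q
moves? turn⁻     p q = p Fin.≟ trn q
moves? kill      p q = (p Fin.≟ q) ×-dec ¬? (p Fin.≟ #1)
moves? copy      p q = (p Fin.≟ q) ⊎-dec ((p Fin.≟ #0) ×-dec (q Fin.≟ #1))
moves? swap      p q = ((p Fin.≟ #0) ×-dec (q Fin.≟ #1)) ⊎-dec (((p Fin.≟ #1) ×-dec (q Fin.≟ #0))
                         ⊎-dec ((p Fin.≟ q) ×-dec (¬? (p Fin.≟ #0) ×-dec ¬? (p Fin.≟ #1))))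
moves? dropIn    p q = p Fin.≟ q
moves? dropOut   p q = p Fin.≟ q
moves? chargeIn  p q = no λ ()
moves? chargeOut p q = no λ ()

enters? : ∀ a (p : Slot k) → Dec (Enters a p)
enters? idle      p = no λ ()
enters? rotate    p = no λ ()
enters? rotate⁻   p = no λ ()
enters? turn      p = no λ ()
enters? turn⁻     p = no λ ()
enters? kill      p = no λ ()
enters? copy      p = no λ ()
enters? swap      p = no λ ()
enters? dropIn    p = p Fin.≟ #0
enters? dropOut   p = no λ ()
enters? chargeIn  p = yes tt
enters? chargeOut p = no λ ()

leaves? : ∀ a (q : Slot k) → Dec (Leaves a q)
leaves? idle      q = no λ ()
leaves? rotate    q = no λ ()
leaves? rotate⁻   q = no λ ()
leaves? turn      q = no λ ()
leaves? turn⁻     q = no λ ()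
leaves? kill      q = no λ ()
leaves? copy      q = no λ ()
leaves? swap      q = no λ ()
leaves? dropIn    q = no λ ()
leaves? dropOut   q = q Fin.≟ #1
leaves? chargeIn  q = no λ ()
leaves? chargeOut q = yes tt

edge? : ∀ a (s t : St k) → Dec (Edge a s t)
edge? a (slot p) (slot q) = moves? a p q
edge? a (slot p) final    = enters? a p
edge? a final    (slot q) = leaves? a q
edge? a final    final    = no λ ()

isFinal : St k → Bool
isFinal final    = true
isFinal (slot _) = false

-- The flag tells whether the final state is left along the path.
data Path {k : ℕ} : List Letter → St k → St k → Bool → Set where
  []   : ∀ {s} → Path [] s s false
  _∷_ : ∀ {a u s t r b} → Edge a s t → Path u t r b → Path (a ∷ u) s r (isFinal s ∨ b)

_++ᴾ_ : ∀ {u w} {s t r : St k} {b c} → Path u s t b → Path w t r c → Path (u ++ w) s r (b ∨ c)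
[] ++ᴾ π = π
_++ᴾ_ {c = c} (_∷_ {s = s} {b = b} e π) π′ =
  subst (Path _ _ _) (sym (∨-assoc (isFinal s) b c)) (e ∷ (π ++ᴾ π′))

split : ∀ u {w} {s r : St k} {b} → Path (u ++ w) s r b →
  ∃ λ t → ∃₂ λ c d → Path u s t c × Path w t r d × b ≡ c ∨ d
split []      π = _ , _ , _ , [] , π , refl
split (a ∷ u) (_∷_ {s = s} e π) with split u π
... | t , c , d , π₁ , π₂ , refl =
  t , _ , d , e ∷ π₁ , π₂ , sym (∨-assoc (isFinal s) c d)

-- A path out of a slot must end in a slot: visits to `final` stay inside the word, so such words
-- can be concatenated.
record Implements (w : List Letter) (R : Slot k → Slot k → Bool → Set) : Set where
  field
    sound    : ∀ {p s b} → Path w (slot p) s b → ∃ λ q → s ≡ slot q × R p q b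
    complete : ∀ {p q b} → R p q b → Path w (slot p) (slot q) b
open Implements public

-- This is how operations on arbitrary slots are spelled from operations on `#0` and `#1` over a
-- bounded alphabet.
conjugate : ∀ {w R} {R′ : Slot k → Slot k → Bool → Set} (a a⁻ : Letter) (π : Slot k → Slot k) →
  (∀ p s → Edge {k} a (slot p) s → s ≡ slot (π p)) → (∀ p → Edge {k} a (slot p) (slot (π p))) →
  (∀ p s → Edge {k} a⁻ (slot p) s → ∃ λ q → s ≡ slot q × p ≡ π q) → (∀ q → Edge {k} a⁻ (slot (π q)) (slot q)) →
  (∀ {p q b} → R (π p) (π q) b → R′ p q b) → (∀ {p q b} → R′ p q b → R (π p) (π q) b) →
  Implements w R → Implements (a ∷ w ++ a⁻ ∷ []) R′
conjugate {w = w} {R} {R′} a a⁻ π a-fun a-edge a⁻-fun a⁻-edge to from I = record { sound = snd ; complete = cmp }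
  where
  snd : ∀ {p s b} → Path (a ∷ w ++ a⁻ ∷ []) (slot p) s b → ∃ λ q → s ≡ slot q × R′ p q b
  snd (_∷_ {t = s₁} e τ) with refl ← a-fun _ s₁ e with split w τ
  ... | t , c , d , τ₁ , (_∷_ {t = s₂} e⁻ []) , refl with sound I τ₁
  ... | q′ , refl , r with a⁻-fun _ s₂ e⁻
  ... | q , refl , refl = q , refl , subst (R′ _ _) (sym (∨-identityʳ _)) (to r)
  cmp : ∀ {p q b} → R′ p q b → Path (a ∷ w ++ a⁻ ∷ []) (slot p) (slot q) b
  cmp {b = b} r = subst (Path _ _ _) (∨-identityʳ b) (a-edge _ ∷ (complete I (from r) ++ᴾ (a⁻-edge _ ∷ [])))

act-map : ∀ o {x y p q : Slot k} {b} (π : Slot k → Slot k) → (∀ p q → π p ≡ π q → p ≡ q) →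
  Act o x y p q b → Act o (π x) (π y) (π p) (π q) b
act-map kills  π i (refl , ne , b)       = refl , ne ∘ i _ _ , b
act-map copies π i (inj₁ refl , b)       = inj₁ refl , b
act-map copies π i (inj₂ (refl , refl) , b) = inj₂ (refl , refl) , b
act-map drops  π i (inj₁ (refl , b))     = inj₁ (refl , b)
act-map drops  π i (inj₂ (refl , refl , b)) = inj₂ (refl , refl , b)
act-map swaps  π i (inj₁ (refl , refl) , b) = inj₁ (refl , refl) , b
act-map swaps  π i (inj₂ (inj₁ (refl , refl)) , b) = inj₂ (inj₁ (refl , refl)) , b
act-map swaps  π i (inj₂ (inj₂ (refl , n , m)) , b) = inj₂ (inj₂ (refl , n ∘ i _ _ , m ∘ i _ _)) , b

act-unmap : ∀ o {x y p q : Slot k} {b} (π : Slot k → Slot k) → (∀ p q → π p ≡ π q → p ≡ q) →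
  Act o (π x) (π y) (π p) (π q) b → Act o x y p q b
act-unmap kills  π i (e , ne , b)       = i _ _ e , ne ∘ cong π , b
act-unmap copies π i (inj₁ e , b)       = inj₁ (i _ _ e) , b
act-unmap copies π i (inj₂ (e , f) , b) = inj₂ (i _ _ e , i _ _ f) , b
act-unmap drops  π i (inj₁ (e , b))     = inj₁ (i _ _ e , b)
act-unmap drops  π i (inj₂ (e , f , b)) = inj₂ (i _ _ e , i _ _ f , b)
act-unmap swaps  π i (inj₁ (e , f) , b) = inj₁ (i _ _ e , i _ _ f) , b
act-unmap swaps  π i (inj₂ (inj₁ (e , f)) , b) = inj₂ (inj₁ (i _ _ e , i _ _ f)) , b
act-unmap swaps  π i (inj₂ (inj₂ (e , n , m)) , b) = inj₂ (inj₂ (i _ _ e , n ∘ cong π , m ∘ cong π)) , b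

rotate-fun : ∀ (p : Slot k) s → Edge rotate (slot p) s → s ≡ slot (rot p)
rotate-fun p (slot q) refl = refl

turn-fun : ∀ (p : Slot k) s → Edge turn (slot p) s → s ≡ slot (trn p)
turn-fun p (slot q) refl = refl

rotate⁻-fun : ∀ (p : Slot k) s → Edge rotate⁻ (slot p) s → ∃ λ q → s ≡ slot q × p ≡ rot q
rotate⁻-fun p (slot q) e = q , refl , e

turn⁻-fun : ∀ (p : Slot k) s → Edge turn⁻ (slot p) s → ∃ λ q → s ≡ slot q × p ≡ trn q
turn⁻-fun p (slot q) e = q , refl , e

basic : ∀ o → ∃ λ w → Implements {k} w (Act o #0 #1)
basic kills = kill ∷ [] , record
  { sound = λ { {s = slot q} ((e , n) ∷ []) → q , refl , e , n , refl }
  ; complete = λ { (e , n , refl) → (e , n) ∷ [] } }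
basic copies = copy ∷ [] , record
  { sound = λ { {s = slot q} (e ∷ []) → q , refl , e , refl }
  ; complete = λ { (e , refl) → e ∷ [] } }
basic swaps = swap ∷ [] , record
  { sound = λ { {s = slot q} (e ∷ []) → q , refl , e , refl }
  ; complete = λ { (e , refl) → e ∷ [] } }
basic drops = dropIn ∷ dropOut ∷ [] , record { sound = snd ; complete = cmp }
  where
  snd : ∀ {p s b} → Path (dropIn ∷ dropOut ∷ []) (slot p) s b → ∃ λ q → s ≡ slot q × Act drops #0 #1 p q b
  snd {s = slot q} (_∷_ {t = slot _} refl (refl ∷ [])) = q , refl , inj₁ (refl , refl)
  snd {s = slot q} (_∷_ {t = final}  refl (refl ∷ [])) = q , refl , inj₂ (refl , refl , refl)
  snd {s = final}  (_∷_ {t = slot _} e (() ∷ []))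
  snd {s = final}  (_∷_ {t = final}  e (() ∷ []))
  cmp : ∀ {p q b} → Act drops #0 #1 p q b → Path (dropIn ∷ dropOut ∷ []) (slot p) (slot q) b
  cmp (inj₁ (refl , refl)) = _∷_ {t = slot _} refl (refl ∷ [])
  cmp (inj₂ (refl , refl , refl)) = _∷_ {t = final} refl (refl ∷ [])

-- Each conjugation by `turn` lowers the second slot by one and fixes slot zero. The number `d`
-- carries the recursion, since `inject₁ y` is not a subterm of `suc y`.
implement₀ : ∀ o d (y : Fin (suc k)) → toℕ y ≡ d → ∃ λ w → Implements {k} w (Act o #0 (suc y))
implement₀ o zero    zero    e = basic o
implement₀ o (suc d) (suc y) e
  with implement₀ o d (inject₁ y) (trans (Fin.toℕ-inject₁ y) (ℕ.suc-injective e))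
... | w , I = _ , conjugate turn turn⁻ trn turn-fun (λ _ → refl) turn⁻-fun (λ _ → refl)
                    (act-unmap o trn trn-injective) (act-map o trn trn-injective) I

implement : ∀ o d (x y : Slot k) → toℕ x ≡ d → x ≢ y → ∃ λ w → Implements w (Act o x y)
implement o zero    zero    zero    e x≢y = contradiction refl x≢y
implement o zero    zero    (suc y) e x≢y = implement₀ o _ y refl
implement o (suc d) (suc x) y       e x≢y
  with implement o d (inject₁ x) (rot y) (trans (Fin.toℕ-inject₁ x) (ℕ.suc-injective e))
         (x≢y ∘ rot-injective (suc x) y)
... | w , I = _ , conjugate rotate rotate⁻ rot rotate-fun (λ _ → refl) rotate⁻-fun (λ _ → refl)
                    (act-unmap o rot rot-injective) (act-map o rot rot-injective) I

-- Acts as the identity, yet moves every thread through slot zero on the way. This supplies a state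
-- that provably recurs, as the Streett condition of the hard automaton requires.
sweep : ℕ → List Letter
sweep zero    = idle ∷ []
sweep (suc d) = rotate ∷ sweep d ++ rotate⁻ ∷ []

sweep-implements : ∀ d → Implements {k} (sweep d) (λ p q b → p ≡ q × b ≡ false)
sweep-implements zero = record
  { sound = λ { {s = slot q} (e ∷ []) → q , refl , e , refl }
  ; complete = λ { (e , refl) → e ∷ [] } }
sweep-implements (suc d) = conjugate rotate rotate⁻ rot rotate-fun (λ _ → refl) rotate⁻-fun (λ _ → refl)
  (λ { (e , b) → rot-injective _ _ e , b }) (λ { (e , b) → cong rot e , b }) (sweep-implements d)

-- Words linking two rankings

Ranking : ℕ → Set
Ranking k = Slot k → ℕ

odd : ℕ → ℕ
odd j = suc (j + j)

even-or-odd : ∀ v → ∃ λ j → v ≡ j + j ⊎ v ≡ odd j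
even-or-odd zero    = 0 , inj₁ refl
even-or-odd (suc v) with even-or-odd v
... | j , inj₁ e = j , inj₂ (cong suc e)
... | j , inj₂ e = suc j , inj₁ (trans (cong suc e) (cong suc (sym (ℕ.+-suc j j))))

double-injective : ∀ {i j} → i + i ≡ j + j → i ≡ j
double-injective {zero}  {zero}  _ = refl
double-injective {suc i} {suc j} e = cong suc (double-injective
  (ℕ.suc-injective (ℕ.suc-injective (trans (cong suc (sym (ℕ.+-suc i i))) (trans e (cong suc (ℕ.+-suc j j)))))))

double<⇒< : ∀ {i m} → i + i < m + m → i < m
double<⇒< {i} {m} lt with i ℕ.<? m
... | yes p = p
... | no ¬p = contradiction (ℕ.+-mono-≤ (ℕ.≮⇒≥ ¬p) (ℕ.≮⇒≥ ¬p)) (ℕ.<⇒≱ lt)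

odd-injective : ∀ {i j} → odd i ≡ odd j → i ≡ j
odd-injective = double-injective ∘ ℕ.suc-injective

record IsQ (m : ℕ) (f : Ranking k) : Set where
  constructor isQ
  field
    bounded : ∀ p → f p < m + m
    attains : ∀ j → j < m → ∃ λ p → f p ≡ odd j
open IsQ public

record Sound (f : Ranking k) (w : List Letter) (g : Ranking k) : Set where
  field
    bounds : ∀ {p s b} → Path w (slot p) s b →
      ∃ λ q → s ≡ slot q × g q ≤ f p × (b ≡ true → g q < f p)
open Sound public

record Complete (f : Ranking k) (w : List Letter) (g : Ranking k) : Set where
  field
    descend : ∀ p q → g q < f p → Path w (slot p) (slot q) true
    keep    : ∀ p q j → f p ≡ odd j → g q ≡ odd j → ∃ λ b → Path w (slot p) (slot q) b
open Complete public

record Link (f g : Ranking k) : Set where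
  constructor link
  field
    word      : List Letter
    soundL    : Sound f word g
    completeL : Complete f word g
open Link public

reach : ∀ {f g : Ranking k} {w} → Complete f w g → ∀ p q j → odd j ≤ f p → g q ≡ odd j →
  ∃ λ b → Path w (slot p) (slot q) b
reach {f = f} C p q j j≤ e with f p ℕ.≟ odd j
... | yes e′ = keep C p q j e′ e
... | no ne = true , descend C p q (subst (_< f p) (sym e) (ℕ.≤∧≢⇒< j≤ (ne ∘ sym)))

Sound-++ : ∀ {f g h : Ranking k} {u w} → Sound f u g → Sound g w h → Sound f (u ++ w) h
bounds (Sound-++ {u = u} S T) π with split u π
... | t , c , d , π₁ , π₂ , refl with bounds S π₁
... | q , refl , le , lt with bounds T π₂
... | r , refl , le′ , lt′ = r , refl , ℕ.≤-trans le′ le , strict c d lt lt′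
  where
  strict : ∀ c d → (c ≡ true → _) → (d ≡ true → _) → c ∨ d ≡ true → _
  strict true  d    lt lt′ _ = ℕ.≤-<-trans le′ (lt refl)
  strict false true lt lt′ _ = ℕ.<-≤-trans (lt′ refl) le

-- An intermediate odd rank is always available, since the middle ranking attains all of them.
Complete-++ : ∀ {m} {f g h : Ranking k} {u w} → (∀ p → f p < m + m) → IsQ m g →
  Complete f u g → Complete g w h → Complete f (u ++ w) h
Complete-++ {m = m} {f} {g} {h} {u} {w} bd Q C D = record { descend = dsc ; keep = kp }
  where
  kp : ∀ p r j → f p ≡ odd j → h r ≡ odd j → ∃ λ b → Path (u ++ w) (slot p) (slot r) b
  kp p r j e e′ with attains Q j (double<⇒< (ℕ.<-trans (ℕ.n<1+n _) (subst (_< m + m) e (bd p))))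
  ... | q , eq with keep C p q j e eq | keep D q r j eq e′
  ... | _ , π | _ , π′ = _ , π ++ᴾ π′
  dsc : ∀ p r → h r < f p → Path (u ++ w) (slot p) (slot r) true
  dsc p r lt with even-or-odd (f p)
  ... | j , inj₂ e with attains Q j (double<⇒< (ℕ.<-trans (ℕ.n<1+n _) (subst (_< m + m) e (bd p))))
  ...   | q , eq with keep C p q j e eq
  ...     | b , π = subst (Path _ _ _) (∨-zeroʳ b) (π ++ᴾ descend D q r (subst (h r <_) (trans e (sym eq)) lt))
  dsc p r lt | zero , inj₁ e = contradiction (subst (h r <_) e lt) λ ()
  -- For `f p` = 2j + 2 the relay slot has the odd rank 2j + 1 just below: the first word already
  -- visits the final state, and the second only has to reach a rank that is not higher.
  dsc p r lt | suc j , inj₁ e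
    with attains Q j (ℕ.<-trans (ℕ.n<1+n j) (double<⇒< (subst (_< m + m) e (bd p))))
  ...   | q , eq = descend C p q (subst₂ _<_ (sym eq) (sym e′) (ℕ.n<1+n _)) ++ᴾ proj₂ lower
    where
    e′ : f p ≡ suc (odd j)
    e′ = trans e (cong suc (ℕ.+-suc j j))
    le : h r ≤ odd j
    le = ℕ.≤-pred (subst (h r <_) e′ lt)
    lower : ∃ λ b → Path w (slot q) (slot r) b
    lower with h r ℕ.≟ odd j
    ... | yes e″ = keep D q r j eq e″
    ... | no ne  = true , descend D q r (subst (h r <_) (sym eq) (ℕ.≤∧≢⇒< le ne))

_⨾_ : ∀ {m} {f g h : Ranking k} → Link f g → Link g h → {IsQ m f} → {IsQ m g} → Link f h
_⨾_ (link u S C) (link w T D) {F} {G} = link (u ++ w) (Sound-++ S T) (Complete-++ (bounded F) G C D)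

op : (o : Op) (x y : Slot k) → x ≢ y → ∃ λ w → Implements w (Act o x y)
op o x y = implement o _ x y refl

Sound-op : ∀ o {x y : Slot k} {f g : Ranking k} (ne : x ≢ y) →
  (∀ {p q b} → Act o x y p q b → g q ≤ f p × (b ≡ true → g q < f p)) → Sound f (proj₁ (op o x y ne)) g
bounds (Sound-op o ne h) π with sound (proj₂ (op o _ _ ne)) π
... | q , e , r = q , e , h r

Sound-copy : ∀ {x y : Slot k} {f : Ranking k} (ne : x ≢ y) → f y ≤ f x → Sound f (proj₁ (op copies x y ne)) f
Sound-copy ne le = Sound-op copies ne λ
  { (inj₁ refl , refl) → ℕ.≤-refl , λ () ; (inj₂ (refl , refl) , refl) → le , λ () }

Sound-drop : ∀ {x y : Slot k} {f : Ranking k} (ne : x ≢ y) → f y < f x → Sound f (proj₁ (op drops x y ne)) f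
Sound-drop ne lt = Sound-op drops ne λ
  { (inj₁ (refl , refl)) → ℕ.≤-refl , λ () ; (inj₂ (refl , refl , refl)) → ℕ.<⇒≤ lt , λ _ → lt }

-- Every admissible pair of slots is served by its own drop or copy. Each of these words also lets
-- every thread stay, so the concatenation contains the paths for all pairs.
module Refresh {k : ℕ} (f : Ranking k) where

  single : Slot k × Slot k → List Letter
  single (x , y) with x Fin.≟ y | ℕ.<-cmp (f y) (f x)
  ... | yes _ | _          = []
  ... | no ne | tri< _ _ _ = proj₁ (op drops x y ne)
  ... | no ne | tri≈ _ _ _ = proj₁ (op copies x y ne)
  ... | no _  | tri> _ _ _ = []

  Sound-[] : Sound f [] f
  bounds Sound-[] [] = _ , refl , ℕ.≤-refl , λ ()

  single-sound : ∀ xy → Sound f (single xy) f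
  single-sound (x , y) with x Fin.≟ y | ℕ.<-cmp (f y) (f x)
  ... | yes _ | _           = Sound-[]
  ... | no ne | tri< lt _ _ = Sound-drop ne lt
  ... | no ne | tri≈ _ e _  = Sound-copy ne (ℕ.≤-reflexive e)
  ... | no _  | tri> _ _ _  = Sound-[]

  single-stay : ∀ xy p → Path (single xy) (slot p) (slot p) false
  single-stay (x , y) p with x Fin.≟ y | ℕ.<-cmp (f y) (f x)
  ... | yes _ | _          = []
  ... | no ne | tri< _ _ _ = complete (proj₂ (op drops x y ne)) (inj₁ (refl , refl))
  ... | no ne | tri≈ _ _ _ = complete (proj₂ (op copies x y ne)) (inj₁ refl , refl)
  ... | no _  | tri> _ _ _ = []

  single-descend : ∀ p q → f q < f p → Path (single (p , q)) (slot p) (slot q) true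
  single-descend p q lt with p Fin.≟ q | ℕ.<-cmp (f q) (f p)
  ... | yes refl | _           = contradiction lt (ℕ.<-irrefl refl)
  ... | no ne | tri< _ _ _     = complete (proj₂ (op drops p q ne)) (inj₂ (refl , refl , refl))
  ... | no ne | tri≈ ¬lt _ _   = contradiction lt ¬lt
  ... | no ne | tri> ¬lt _ _   = contradiction lt ¬lt

  single-keep : ∀ p q → f q ≡ f p → Path (single (p , q)) (slot p) (slot q) false
  single-keep p q e with p Fin.≟ q | ℕ.<-cmp (f q) (f p)
  ... | yes refl | _           = []
  ... | no ne | tri< _ ¬e _    = contradiction e ¬e
  ... | no ne | tri≈ _ _ _     = complete (proj₂ (op copies p q ne)) (inj₂ (refl , refl) , refl)
  ... | no ne | tri> _ ¬e _    = contradiction e ¬e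

  all-stay : ∀ xys (p : Slot k) → Path (concatMap single xys) (slot p) (slot p) false
  all-stay []         p = []
  all-stay (xy ∷ xys) p = single-stay xy p ++ᴾ all-stay xys p

  all-sound : ∀ xys → Sound f (concatMap single xys) f
  all-sound []         = Sound-[]
  all-sound (xy ∷ xys) = Sound-++ (single-sound xy) (all-sound xys)

  all-reach : ∀ xys {p q b} → (p , q) ∈ xys → Path (single (p , q)) (slot p) (slot q) b →
    Path (concatMap single xys) (slot p) (slot q) b
  all-reach (_ ∷ xys) {b = b} (here refl) π = subst (Path _ _ _) (∨-identityʳ b) (π ++ᴾ all-stay xys _)
  all-reach (xy ∷ xys) (there i) π = single-stay xy _ ++ᴾ all-reach xys i π

  pairs : List (Slot k × Slot k)
  pairs = cartesianProduct (allFin _) (allFin _)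

  refresh : Link f f
  refresh = link (concatMap single pairs) (all-sound pairs) record
    { descend = λ p q lt → all-reach pairs (∈-cartesianProduct⁺ (∈-allFin p) (∈-allFin q)) (single-descend p q lt)
    ; keep = λ p q j e e′ → _ , all-reach pairs (∈-cartesianProduct⁺ (∈-allFin p) (∈-allFin q))
                                  (single-keep p q (trans e′ (sym e))) }

open Refresh public using (refresh)

-- After a refresh it suffices that every new rank is witnessed by an old one.
extend : ∀ {f g : Ranking k} {w} → Sound f w g →
  (∀ q → (∃ λ r → g q ≡ f r × Path w (slot r) (slot q) false) ⊎
         (∃ λ r → ∃ λ j → g q ≡ j + j × f r ≡ odd j × Path w (slot r) (slot q) true)) →
  Link f g
extend {f = f} {g} {w} S wit = link (word (refresh f) ++ w) (Sound-++ (soundL (refresh f)) S)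
  record { descend = dsc ; keep = kp }
  where
  C = completeL (refresh f)
  dsc : ∀ p q → g q < f p → Path (word (refresh f) ++ w) (slot p) (slot q) true
  dsc p q lt with wit q
  ... | inj₁ (r , e , π) = descend C p r (subst (_< f p) e lt) ++ᴾ π
  ... | inj₂ (r , j , e , e′ , π) with reach C p r j (subst (_< f p) e lt) e′
  ...   | b , τ = subst (Path _ _ _) (∨-zeroʳ b) (τ ++ᴾ π)
  kp : ∀ p q j → f p ≡ odd j → g q ≡ odd j → ∃ λ b → Path (word (refresh f) ++ w) (slot p) (slot q) b
  kp p q j e e′ with wit q
  ... | inj₁ (r , e″ , π) = _ , proj₂ (keep C p r j e (trans (sym e″) e′)) ++ᴾ π
  ... | inj₂ (r , i , e″ , _ , π) = contradiction (trans (sym e″) e′) (even≢odd i j)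
    where
    even≢odd : ∀ i j → i + i ≢ odd j
    even≢odd (suc i) zero eq = contradiction (trans (sym (ℕ.+-suc i i)) (ℕ.suc-injective eq)) λ ()
    even≢odd (suc i) (suc j) eq = even≢odd i j (ℕ.suc-injective (ℕ.suc-injective
      (trans (cong suc (sym (ℕ.+-suc i i))) (trans eq (cong (λ n → suc (suc n)) (ℕ.+-suc j j))))))

exchange : (x y q : Slot k) → Slot k
exchange x y q with q Fin.≟ x | q Fin.≟ y
... | yes _ | _     = y
... | no _  | yes _ = x
... | no _  | no _  = q

exchange-act : ∀ (x y : Slot k) q → Act swaps x y (exchange x y q) q false
exchange-act x y q with q Fin.≟ x | q Fin.≟ y
... | yes refl | _        = inj₂ (inj₁ (refl , refl)) , refl
... | no _     | yes refl = inj₁ (refl , refl) , refl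
... | no n     | no n′    = inj₂ (inj₂ (refl , n , n′)) , refl

act-exchange : ∀ {x y p q : Slot k} {b} → Act swaps x y p q b → p ≡ exchange x y q × b ≡ false
act-exchange {x = x} {y} {p} {q} (r , e) = fun r , e
  where
  fun : (p ≡ x × q ≡ y) ⊎ (p ≡ y × q ≡ x) ⊎ (p ≡ q × p ≢ x × p ≢ y) → p ≡ exchange x y q
  fun r with q Fin.≟ x | q Fin.≟ y
  fun (inj₁ (refl , refl))        | yes e | _     = sym e
  fun (inj₂ (inj₁ (refl , _)))    | yes e | _     = refl
  fun (inj₂ (inj₂ (refl , n , _))) | yes e | _    = contradiction e n
  fun (inj₁ (refl , _))           | no _ | yes _  = refl
  fun (inj₂ (inj₁ (_ , e)))       | no n | yes _  = contradiction e n
  fun (inj₂ (inj₂ (refl , _ , n))) | no _ | yes e = contradiction e n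
  fun (inj₁ (_ , e))              | no _ | no n   = contradiction e n
  fun (inj₂ (inj₁ (_ , e)))       | no n | no _   = contradiction e n
  fun (inj₂ (inj₂ (e , _)))       | no _ | no _   = e

exchange-other : ∀ {x y q : Slot k} → q ≢ x → q ≢ y → exchange x y q ≡ q
exchange-other {x = x} {y} {q} n n′ with q Fin.≟ x | q Fin.≟ y
... | yes e | _     = contradiction e n
... | no _  | yes e = contradiction e n′
... | no _  | no _  = refl

exchange-right : ∀ {x y : Slot k} → x ≢ y → exchange x y y ≡ x
exchange-right {x = x} {y} n with y Fin.≟ x | y Fin.≟ y
... | yes e | _      = contradiction (sym e) n
... | no _  | yes _  = refl
... | no _  | no n′  = contradiction refl n′

exchange-left : ∀ (x y : Slot k) → exchange x y x ≡ y
exchange-left x y with x Fin.≟ x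
... | yes _ = refl
... | no n  = contradiction refl n

exchange-surjective : ∀ (x y p : Slot k) → x ≢ y → ∃ λ q → exchange x y q ≡ p
exchange-surjective x y p x≢y with p Fin.≟ x | p Fin.≟ y
... | yes refl | _        = y , exchange-right x≢y
... | no _     | yes refl = x , exchange-left x y
... | no n     | no n′    = p , exchange-other n n′

swap-link : (f : Ranking k) (x y : Slot k) → x ≢ y → Link f (f ∘ exchange x y)
swap-link f x y ne = extend
  (Sound-op swaps ne λ {p} {q} a → lemma {p} {q} (act-exchange {p = p} {q} a))
  λ q → inj₁ (exchange x y q , refl , complete (proj₂ (op swaps x y ne)) (exchange-act x y q))
  where
  lemma : ∀ {p q b} → p ≡ exchange x y q × b ≡ false →
    f (exchange x y q) ≤ f p × (b ≡ true → f (exchange x y q) < f p)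
  lemma (refl , refl) = ℕ.≤-refl , λ ()

_[_≔_] : Ranking k → Slot k → ℕ → Ranking k
(f [ y ≔ v ]) q with q Fin.≟ y
... | yes _ = v
... | no _  = f q

update-same : ∀ (f : Ranking k) y v → (f [ y ≔ v ]) y ≡ v
update-same f y v with y Fin.≟ y
... | yes _ = refl
... | no n  = contradiction refl n

update-other : ∀ (f : Ranking k) {y} v {q} → q ≢ y → (f [ y ≔ v ]) q ≡ f q
update-other f {y} v {q} n with q Fin.≟ y
... | yes e = contradiction e n
... | no _  = refl

module _ (f : Ranking k) {x y : Slot k} (x≢y : x ≢ y) (v : ℕ) where

  private
    g = f [ y ≔ v ]

    -- The old thread of `y` has to die: if `v` exceeds `f y`, its rank would rise.
    erase-sound : Sound f (proj₁ (op kills x y x≢y)) g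
    erase-sound = Sound-op kills x≢y λ { (refl , n , refl) → ℕ.≤-reflexive (update-other f v n) , λ () }

    erase-stay : ∀ {q} → q ≢ y → Path (proj₁ (op kills x y x≢y)) (slot q) (slot q) false
    erase-stay n = complete (proj₂ (op kills x y x≢y)) (refl , n , refl)

    gx : g x ≡ f x
    gx = update-other f v x≢y

  change-odd : f x ≡ v → Link f g
  change-odd e = extend
    (Sound-++ erase-sound (Sound-copy x≢y (ℕ.≤-reflexive (trans (update-same f y v) (trans (sym e) (sym gx))))))
    wit
    where
    wit : ∀ q → _
    wit q with q Fin.≟ y
    ... | yes refl = inj₁ (x , trans (update-same f y v) (sym e) , erase-stay x≢y ++ᴾ complete (proj₂ (op copies x y x≢y)) (inj₂ (refl , refl) , refl))
    ... | no n     = inj₁ (q , update-other f v n , erase-stay n ++ᴾ complete (proj₂ (op copies x y x≢y)) (inj₁ refl , refl))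

  -- An even rank 2j need not occur among the old ranks, but a drop from the odd rank 2j + 1 creates
  -- it.
  change-even : ∀ j → v ≡ j + j → f x ≡ odd j → Link f g
  change-even j e e′ = extend
    (Sound-++ erase-sound (Sound-drop x≢y (subst₂ _<_ (sym (trans (update-same f y v) e)) (sym (trans gx e′)) (ℕ.n<1+n _))))
    wit
    where
    wit : ∀ q → _
    wit q with q Fin.≟ y
    ... | yes refl = inj₂ (x , j , trans (update-same f y v) e , e′ , erase-stay x≢y ++ᴾ complete (proj₂ (op drops x y x≢y)) (inj₂ (refl , refl , refl)))
    ... | no n     = inj₁ (q , update-other f v n , erase-stay n ++ᴾ complete (proj₂ (op drops x y x≢y)) (inj₁ (refl , refl)))

Link-resp : ∀ {f g h : Ranking k} → g ≗ h → Link f g → Link f h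
Link-resp {f = f} {g} {h} e (link w S C) = link w S′ record
  { descend = λ p q lt → descend C p q (subst (_< f p) (sym (e q)) lt)
  ; keep = λ p q j a b → keep C p q j a (trans (e q) b) }
  where
  S′ : Sound f w h
  bounds S′ π with bounds S π
  ... | q , s , le , lt = q , s , subst (_≤ f _) (e q) le , λ t → subst (_< f _) (e q) (lt t)

-- Connecting two arbitrary Q-rankings

module Connect {m : ℕ} (f g : Ranking k) (F : IsQ m f) (G : IsQ m g) where

  rep : ∀ {j} → j < m → Slot k
  rep lt = proj₁ (attains G _ lt)

  rep-odd : ∀ {j} (lt : j < m) → g (rep lt) ≡ odd j
  rep-odd lt = proj₂ (attains G _ lt)

  record Stage (P : Ranking k → Set) : Set where
    constructor stage
    field
      {current} : Ranking k
      linked    : Link f current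
      ranking   : IsQ m current
      invariant : P current

  Aligned : ℕ → Ranking k → Set
  Aligned i h = ∀ {j} (lt : j < m) → j < i → h (rep lt) ≡ odd j

  -- Swaps suffice: the current ranking attains 2i + 1 at some slot `a`, and exchanging `a` with the
  -- slot where `g` has this rank puts it in place.
  align : ∀ i → i ≤ m → Stage (Aligned i)
  align zero    _   = stage (refresh f) F λ _ ()
  align (suc i) i<m with align i (ℕ.<⇒≤ i<m)
  ... | stage {h} L H al with attains H i i<m
  ... | a , ha with a Fin.≟ rep i<m
  ...   | yes refl = stage L H new
    where
    new : Aligned (suc i) h
    new {j} lt j≤i with j ℕ.≟ i
    ... | yes refl = trans (cong (h ∘ rep) (ℕ.<-irrelevant lt i<m)) ha
    ... | no ne    = al lt (ℕ.≤∧≢⇒< (ℕ.≤-pred j≤i) ne)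
  ...   | no ne = stage (_⨾_ L (swap-link h a (rep i<m) ne) {F} {H}) (isQ (bounded H ∘ τ) att) new
    where
    τ = exchange a (rep i<m)
    att : ∀ j → j < m → ∃ λ p → h (τ p) ≡ odd j
    att j lt with attains H j lt
    ... | p , e with exchange-surjective a (rep i<m) p ne
    ... | q , refl = q , e
    new : Aligned (suc i) (h ∘ τ)
    new {j} lt j≤i with j ℕ.≟ i
    ... | yes refl = trans (cong h (trans (cong (τ ∘ rep) (ℕ.<-irrelevant lt i<m)) (exchange-right ne))) ha
    -- Neither exchanged slot is an earlier representative: that one has rank 2j + 1 under both `h`
    -- and `g`, whereas `a` has rank 2i + 1 under `h` and the new representative has it under `g`.
    ... | no j≢i = trans (cong h (exchange-other
            (λ e → j≢i (odd-injective (trans (sym hj) (trans (cong h e) ha))))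
            (λ e → j≢i (odd-injective (trans (sym (rep-odd lt)) (trans (cong g e) (rep-odd i<m))))))) hj
      where
      hj : h (rep lt) ≡ odd j
      hj = al lt (ℕ.≤∧≢⇒< (ℕ.≤-pred j≤i) j≢i)

  Agrees : ℕ → Ranking k → Set
  Agrees i h = Aligned m h × (∀ p → toℕ p < i → h p ≡ g p)

  -- Aligned representatives are never altered again, so all odd ranks stay available. Any other
  -- slot is filled from the representative of its new rank if that is odd, and of the next higher
  -- rank if it is even.
  agree : ∀ i → i ≤ suc (suc k) → Stage (Agrees i)
  agree zero _ with align m ℕ.≤-refl
  ... | stage L H al = stage L H (al , λ _ ())
  agree (suc i) i<K with agree i (ℕ.<⇒≤ i<K)
  ... | stage {h} L H (al , ag) with h y ℕ.≟ g y
    where y = fromℕ< i<K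
  ...   | yes e = stage L H (al , new)
    where
    new : ∀ p → toℕ p < suc i → h p ≡ g p
    new p lt with toℕ p ℕ.≟ i
    ... | no ne    = ag p (ℕ.≤∧≢⇒< (ℕ.≤-pred lt) ne)
    ... | yes refl = subst (λ q → h q ≡ g q) (Fin.fromℕ<-toℕ p i<K) e
  ...   | no h≢g = stage (_⨾_ L change {F} {H}) (isQ bd att) (al′ , new)
    where
    y = fromℕ< i<K
    v = g y
    rep≢y : ∀ {j} (lt : j < m) → rep lt ≢ y
    rep≢y lt e = h≢g (trans (cong h (sym e)) (trans (trans (al lt lt) (sym (rep-odd lt))) (cong g e)))
    change : Link h (h [ y ≔ v ])
    change with even-or-odd v
    ... | j , inj₂ e = change-odd h (rep≢y lt) v (trans (al lt lt) (sym e))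
      where
      lt : j < m
      lt = double<⇒< (ℕ.<-trans (ℕ.n<1+n _) (subst (_< m + m) e (bounded G y)))
    ... | j , inj₁ e = change-even h (rep≢y lt) v j e (al lt lt)
      where
      lt : j < m
      lt = double<⇒< (subst (_< m + m) e (bounded G y))
    bd : ∀ p → (h [ y ≔ v ]) p < m + m
    bd p with p Fin.≟ y
    ... | yes _ = bounded G y
    ... | no _  = bounded H p
    al′ : Aligned m (h [ y ≔ v ])
    al′ lt lt′ = trans (update-other h v (rep≢y lt)) (al lt lt′)
    att : ∀ j → j < m → ∃ λ p → (h [ y ≔ v ]) p ≡ odd j
    att j lt = rep lt , al′ lt lt
    new : ∀ p → toℕ p < suc i → (h [ y ≔ v ]) p ≡ g p
    new p lt with toℕ p ℕ.≟ i
    ... | yes refl = subst (λ q → (h [ y ≔ v ]) q ≡ g q) (Fin.fromℕ<-toℕ p i<K) (update-same h y v)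
    ... | no ne    = trans (update-other h v (λ e → ne (trans (cong toℕ e) (Fin.toℕ-fromℕ< i<K))))
                       (ag p (ℕ.≤∧≢⇒< (ℕ.≤-pred lt) ne))

  connect : Link f g
  connect with agree (suc (suc k)) ℕ.≤-refl
  ... | stage L _ (_ , ag) = Link-resp (λ p → ag p (Fin.toℕ<n p)) L

open Connect public using (connect)

-- Infinite concatenations

Inf : (ℕ → Bool) → Set
Inf P = ∀ i → ∃ λ j → i ≤ j × P j ≡ true

module _ {X : Set} (_⟶_ : X → X → Set) where

  data Chain : X → List X → X → Set where
    []  : ∀ {x} → Chain x [] x
    _∷_ : ∀ {x y l z} → x ⟶ y → Chain y l z → Chain x (x ∷ l) z

module _ {X : Set} {_⟶_ : X → X → Set} where

  _++ᶜ_ : ∀ {x y z l l′} → Chain _⟶_ x l y → Chain _⟶_ y l′ z → Chain _⟶_ x (l ++ l′) z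
  []      ++ᶜ d = d
  (e ∷ c) ++ᶜ d = e ∷ (c ++ᶜ d)

  redirect : ∀ {x l y z} → (∀ {w} → w ⟶ y → w ⟶ z) → 0 < length l → Chain _⟶_ x l y → Chain _⟶_ x l z
  redirect f _ (e ∷ [])      = f e ∷ []
  redirect f _ (e ∷ e′ ∷ c)  = e ∷ redirect f z<s (e′ ∷ c)

  module Concat (s : ℕ → X) (l : ℕ → List X)
    (chain : ∀ i → Chain _⟶_ (s i) (l i) (s (suc i))) (nonempty : ∀ i → 0 < length (l i)) where

    -- A place inside one of the chains. Since no chain is empty, one step always reaches a further
    -- element, at worst the first one of the next chain.
    record Cursor : Set where
      constructor cursor
      field
        index      : ℕ
        {pos succ} : X
        {rest}     : List X
        edge       : pos ⟶ succ
        tail       : Chain _⟶_ succ rest (s (suc index))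
        within     : ∀ x → x ∈ pos ∷ rest → x ∈ l index
    open Cursor public

    begin : ∀ {i x xs z} → Chain _⟶_ x xs z → z ≡ s (suc i) → 0 < length xs →
      (∀ y → y ∈ xs → y ∈ l i) → Cursor
    begin {i} (e ∷ c) refl _ sub = cursor i e c sub

    start : ℕ → Cursor
    start i = begin (chain i) refl (nonempty i) (λ _ → id)

    pos-begin : ∀ {i x xs z} (c : Chain _⟶_ x xs z) e n sub → pos (begin {i} c e n sub) ≡ x
    pos-begin (e ∷ c) refl _ _ = refl

    index-begin : ∀ {i x xs z} (c : Chain _⟶_ x xs z) e n sub → i ≡ index (begin {i} c e n sub)
    index-begin (e ∷ c) refl _ _ = refl

    pos-start : ∀ i → pos (start i) ≡ s i
    pos-start i = pos-begin (chain i) refl (nonempty i) (λ _ → id)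

    next : Cursor → Cursor
    next (cursor i e []        sub) = start (suc i)
    next (cursor i e (e′ ∷ c)  sub) = cursor i e′ c (λ z → sub z ∘ there)

    next-edge : ∀ c → pos c ⟶ pos (next c)
    next-edge (cursor i e []       sub) = subst (_ ⟶_) (sym (pos-start (suc i))) e
    next-edge (cursor i e (e′ ∷ c) sub) = e

    advance : ℕ → Cursor → Cursor
    advance zero    c = c
    advance (suc d) c = next (advance d c)

    advance-+ : ∀ d e c → advance (d + e) c ≡ advance d (advance e c)
    advance-+ zero    e c = refl
    advance-+ (suc d) e c = cong next (advance-+ d e c)

    advance-next : ∀ d c → advance d (next c) ≡ advance (suc d) c
    advance-next zero    c = refl
    advance-next (suc d) c = cong next (advance-next d c)

    index-advance : ∀ d c → index c ≤ index (advance d c)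
    index-advance zero    c = ℕ.≤-refl
    index-advance (suc d) c = ℕ.≤-trans (index-advance d c) (index-next (advance d c))
      where
      index-next : ∀ c → index c ≤ index (next c)
      index-next (cursor i e []       sub) =
        ℕ.≤-trans (ℕ.n≤1+n i) (ℕ.≤-reflexive (index-begin (chain (suc i)) refl (nonempty (suc i)) (λ _ → id)))
      index-next (cursor i e (e′ ∷ c) sub) = ℕ.≤-refl

    finish : ∀ {i x y r} (e : x ⟶ y) (c : Chain _⟶_ y r (s (suc i))) sub →
      advance (suc (length r)) (cursor i e c sub) ≡ start (suc i)
    finish e []       sub = refl
    finish {r = _ ∷ r} e (e′ ∷ c) sub = trans (sym (advance-next (suc (length r)) (cursor _ e (e′ ∷ c) sub))) (finish e′ c (λ z → sub z ∘ there))

    visit : ∀ {i x y r} (e : x ⟶ y) (c : Chain _⟶_ y r (s (suc i))) sub {z} → z ∈ x ∷ r →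
      ∃ λ d → pos (advance d (cursor i e c sub)) ≡ z
    visit e c         sub (here refl) = 0 , refl
    visit e (e′ ∷ c)  sub (there m) with visit e′ c (λ z → sub z ∘ there) m
    ... | d , p = suc d , trans (cong pos (sym (advance-next d (cursor _ e (e′ ∷ c) sub)))) p

    finish-begin : ∀ {i x xs z} (c : Chain _⟶_ x xs z) e n sub →
      ∃ λ d → advance (suc d) (begin {i} c e n sub) ≡ start (suc i)
    finish-begin {xs = _ ∷ r} (e ∷ c) refl _ sub = length r , finish e c sub

    visit-begin : ∀ {i x xs z} (c : Chain _⟶_ x xs z) e n sub {y} → y ∈ xs →
      ∃ λ d → pos (advance d (begin {i} c e n sub)) ≡ y
    visit-begin (e ∷ c) refl _ sub = visit e c sub

    reach-start : ∀ i → ∃ λ j → i ≤ j × advance j (start 0) ≡ start i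
    reach-start zero = 0 , z≤n , refl
    reach-start (suc i) with reach-start i
    ... | j , i≤j , eq with finish-begin (chain i) refl (nonempty i) (λ _ → id)
    ... | d , eq′ = suc d + j , s≤s (ℕ.≤-trans i≤j (ℕ.m≤n+m j d)) ,
      trans (advance-+ (suc d) j (start 0)) (trans (cong (advance (suc d)) eq) eq′)

    seq : ℕ → X
    seq j = pos (advance j (start 0))

    seq-edge : ∀ j → seq j ⟶ seq (suc j)
    seq-edge j = next-edge (advance j (start 0))

    seq-start : seq 0 ≡ s 0
    seq-start = pos-start 0

    -- The bound on j holds because each earlier chain takes at least one step.
    visits : ∀ {i x} → x ∈ l i → ∃ λ j → i ≤ j × seq j ≡ x
    visits {i} {x} m with reach-start i | visit-begin (chain i) refl (nonempty i) (λ _ → id) m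
    ... | j , i≤j , eq | d , p = d + j , ℕ.≤-trans i≤j (ℕ.m≤n+m j d) ,
      trans (cong pos (trans (advance-+ d j (start 0)) (cong (advance d) eq))) p

    -- Needed to show that whatever recurs in the sequence comes up in arbitrarily late chains.
    eventually : ∀ i → ∃ λ j → ∀ j′ → j ≤ j′ → ∃ λ i′ → i ≤ i′ × seq j′ ∈ l i′
    eventually i with reach-start i
    ... | j , _ , eq = j , λ j′ j≤j′ → index (advance j′ (start 0)) ,
      subst (i ≤_) (cong index (trans (cong (advance (j′ ∸ j)) (sym eq))
        (trans (sym (advance-+ (j′ ∸ j) j (start 0))) (cong (λ n → advance n (start 0)) (ℕ.m∸n+n≡m j≤j′)))))
        (ℕ.≤-trans (ℕ.≤-reflexive (index-begin (chain i) refl (nonempty i) (λ _ → id))) (index-advance (j′ ∸ j) (start i))) ,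
      within (advance j′ (start 0)) _ (here refl)

-- Idle beyond the end of the word.
at : List Letter → ℕ → Letter
at []      _       = idle
at (a ∷ u) zero    = a
at (a ∷ u) (suc o) = at u o

at-++ˡ : ∀ u {w o} → o < length u → at (u ++ w) o ≡ at u o
at-++ˡ (a ∷ u) {o = zero}  _        = refl
at-++ˡ (a ∷ u) {o = suc o} (s≤s lt) = at-++ˡ u lt

at-++ʳ : ∀ u {w} o → at (u ++ w) (length u + o) ≡ at w o
at-++ʳ []      o = refl
at-++ʳ (a ∷ u) o = at-++ʳ u o

record Spells (α : ℕ → Letter) (t : ℕ) (u : List Letter) : Set where
  constructor spells
  field
    spell : ∀ o → o < length u → α (t + o) ≡ at u o
open Spells public

spells-++ˡ : ∀ {α t} u {w} → Spells α t (u ++ w) → Spells α t u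
spell (spells-++ˡ u {w} S) o lt =
  trans (spell S o (ℕ.<-≤-trans lt (subst (length u ≤_) (sym (length-++ u)) (ℕ.m≤m+n _ (length w))))) (at-++ˡ u lt)

spells-++ʳ : ∀ {α t} u {w} → Spells α t (u ++ w) → Spells α (t + length u) w
spell (spells-++ʳ {α} {t} u {w} S) o lt = trans (cong α (ℕ.+-assoc t (length u) o))
  (trans (spell S (length u + o) (subst (length u + o <_) (sym (length-++ u)) (ℕ.+-monoʳ-< (length u) lt))) (at-++ʳ u o))

spells-∷ : ∀ {α t a u} → Spells α t (a ∷ u) → α t ≡ a × Spells α (suc t) u
spells-∷ {α} {t} {a} {u} S = trans (cong α (sym (ℕ.+-identityʳ t))) (spell S 0 z<s) ,
  spells λ o lt → trans (cong α (sym (ℕ.+-suc t o))) (spell S (suc o) (s<s lt))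

Traces : (ℕ → Letter) → (ℕ → St k) → Set
Traces α σ = ∀ t → Edge (α t) (σ t) (σ (suc t))

trace-path : ∀ {α} {σ : ℕ → St k} → Traces α σ → ∀ u t → Spells α t u →
  ∃ λ b → Path u (σ t) (σ (t + length u)) b × (∀ o → o < length u → σ (t + o) ≡ final → b ≡ true)
trace-path {σ = σ} R [] t S = false , subst (λ n → Path [] (σ t) (σ n) false) (sym (ℕ.+-identityʳ t)) [] , λ o ()
trace-path {α = α} {σ} R (a ∷ u) t S with spells-∷ S
... | refl , S′ with trace-path {α = α} {σ} R u (suc t) S′
... | b , π , v = isFinal (σ t) ∨ b ,
  subst (λ n → Path (a ∷ u) (σ t) (σ n) (isFinal (σ t) ∨ b)) (sym (ℕ.+-suc t (length u))) (R t ∷ π) , vis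
  where
  vis : ∀ o → o < suc (length u) → σ (t + o) ≡ final → isFinal (σ t) ∨ b ≡ true
  vis zero    _        e rewrite trans (cong σ (sym (ℕ.+-identityʳ t))) e = refl
  vis (suc o) (s≤s lt) e rewrite v o lt (trans (cong σ (sym (ℕ.+-suc t o))) e) = ∨-zeroʳ _

-- Walks that read α but may, whenever ρ repeats a value, jump to another position with that value.
module Jumps {k : ℕ} {Y : Set} (α : ℕ → Letter) (ρ : ℕ → Y) where

  -- With ρ a run of `B`, the equation says that the state after reading position p is the state at
  -- the next position read; so the positions of a walk carry a run of `B` over the rearranged word.
  _↝_ : ℕ × St k → ℕ × St k → Set
  (p , s) ↝ (p′ , s′) = ρ (suc p) ≡ ρ p′ × Edge (α p) s s′

  -- `covers` and `within` serve to compare the recurring states of ρ before and after rearranging: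
  -- a segment reads all of its interval and nothing else.
  record Seg (t t′ : ℕ) (s s′ : St k) (b : Bool) : Set where
    field
      list   : List (ℕ × St k)
      chain  : Chain _↝_ (t , s) list (t′ , s′)
      covers : ∀ {p} → t ≤ p → p < t′ → ∃ λ r → (p , r) ∈ list
      within : ∀ {p r} → (p , r) ∈ list → t ≤ p × p < t′
      hits   : b ≡ true → ∃ λ p → (p , final) ∈ list
  open Seg public

  path-seg : ∀ {u s s′ b} t → Spells α t u → Path u s s′ b → Seg t (t + length u) s s′ b
  path-seg {s = s} t S [] = record
    { list = [] ; chain = subst (λ n → Chain _↝_ (t , s) [] (n , s)) (sym (ℕ.+-identityʳ t)) []
    ; covers = λ {p} t≤p p<t → contradiction (subst (p <_) (ℕ.+-identityʳ t) p<t) (ℕ.≤⇒≯ t≤p)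
    ; within = λ () ; hits = λ () }
  path-seg {a ∷ u} {s} {s′} t S (_∷_ {t = r} {b = b} e π) with spells-∷ S
  ... | refl , S′ = record
    { list = (t , s) ∷ list T
    ; chain = subst (λ n → Chain _↝_ (t , s) ((t , s) ∷ list T) (n , s′)) (sym (ℕ.+-suc t (length u))) ((refl , e) ∷ chain T)
    ; covers = cov
    ; within = λ { (here refl) → ℕ.≤-refl , ℕ.m<m+n t z<s
                 ; {p} (there m) → ℕ.<⇒≤ (proj₁ (within T m)) , subst (p <_) (sym (ℕ.+-suc t (length u))) (proj₂ (within T m)) }
    ; hits = hit s refl }
    where
    T = path-seg (suc t) S′ π
    cov : ∀ {p} → t ≤ p → p < t + suc (length u) → ∃ λ q → (p , q) ∈ (t , s) ∷ list T
    cov {p} t≤p p<t′ with t ℕ.≟ p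
    ... | yes refl = s , here refl
    ... | no ne with covers T (ℕ.≤∧≢⇒< t≤p ne) (subst (p <_) (ℕ.+-suc t (length u)) p<t′)
    ...   | q , m = q , there m
    hit : ∀ s₀ → s₀ ≡ s → isFinal s₀ ∨ b ≡ true → ∃ λ p → (p , final) ∈ (t , s) ∷ list T
    hit final    refl _ = t , here refl
    hit (slot _) _    e with hits T e
    ... | p , m = p , there m

  seg-length : ∀ {t t′ s s′ b} → t < t′ → (T : Seg t t′ s s′ b) → 0 < length (list T)
  seg-length lt T with list T | covers T ℕ.≤-refl lt
  ... | _ ∷ _ | _ = z<s

  _++ˢ_ : ∀ {t t′ t″ s s′ s″ b c} → Seg t t′ s s′ b → Seg t′ t″ s′ s″ c →
    {t ≤ t′} → {t′ ≤ t″} → Seg t t″ s s″ (b ∨ c)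
  _++ˢ_ {t} {t′} {t″} {b = b} {c} T U {le} {le′} = record
    { list = list T ++ list U
    ; chain = chain T ++ᶜ chain U
    ; covers = cov
    ; within = wth
    ; hits = hit b refl }
    where
    cov : ∀ {p} → t ≤ p → p < t″ → ∃ λ q → (p , q) ∈ list T ++ list U
    cov {p} a z with p ℕ.<? t′
    ... | yes lt with covers T a lt
    ...   | q , m = q , ∈-++⁺ˡ m
    cov {p} a z | no ge with covers U (ℕ.≮⇒≥ ge) z
    ...   | q , m = q , ∈-++⁺ʳ (list T) m
    wth : ∀ {p r} → (p , r) ∈ list T ++ list U → t ≤ p × p < t″
    wth m with ∈-++⁻ (list T) m
    ... | inj₁ m′ = proj₁ (within T m′) , ℕ.<-≤-trans (proj₂ (within T m′)) le′
    ... | inj₂ m′ = ℕ.≤-trans le (proj₁ (within U m′)) , proj₂ (within U m′)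
    hit : ∀ b₀ → b₀ ≡ b → b₀ ∨ c ≡ true → ∃ λ p → (p , final) ∈ list T ++ list U
    hit true  refl _ with hits T refl
    ... | p , m = p , ∈-++⁺ˡ m
    hit false _ e with hits U e
    ... | p , m = p , ∈-++⁺ʳ (list T) m

  empty-seg : ∀ {t s} → Seg t t s s false
  empty-seg = record { list = [] ; chain = [] ; covers = λ a b → contradiction b (ℕ.≤⇒≯ a) ; within = λ () ; hits = λ () }

  land : ∀ {x l t t′ s} → ρ t ≡ ρ t′ → 0 < length l → Chain _↝_ x l (t , s) → Chain _↝_ x l (t′ , s)
  land e = redirect λ { (e′ , ed) → trans e′ e , ed }

-- The words of the fooling argument

module Blocks {k m : ℕ} {f₀ : Ranking k} (F₀ : IsQ m f₀) where

  -- Rankings are visited in reverse order: of two cuts, the earlier has the lexicographically larger ranking.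
  loops : ∀ {gs : List (Ranking k)} → All (IsQ m) gs → Link f₀ f₀
  loops []       = refresh f₀
  loops (G ∷ Gs) = _⨾_ (_⨾_ (loops Gs) (connect f₀ _ F₀ G) {F₀} {F₀}) (connect _ f₀ G F₀) {F₀} {G}

  before : ∀ {gs : List (Ranking k)} → All (IsQ m) gs → (l : Fin (length gs)) → Link f₀ (lookup gs l)
  before (G ∷ Gs) zero    = _⨾_ (loops Gs) (connect f₀ _ F₀ G) {F₀} {F₀}
  before (G ∷ Gs) (suc l) = before Gs l

  lookupQ : ∀ {gs : List (Ranking k)} → All (IsQ m) gs → (l : Fin (length gs)) → IsQ m (lookup gs l)
  lookupQ (G ∷ Gs) zero    = G
  lookupQ (G ∷ Gs) (suc l) = lookupQ Gs l

  after : ∀ {gs : List (Ranking k)} → All (IsQ m) gs → (l : Fin (length gs)) → Link (lookup gs l) f₀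
  after (G ∷ Gs) zero    = connect _ f₀ G F₀
  after (G ∷ Gs) (suc l) =
    _⨾_ (_⨾_ (after Gs l) (connect f₀ _ F₀ G) {lookupQ Gs l} {F₀}) (connect _ f₀ G F₀) {lookupQ Gs l} {G}

  -- All cuts lie in one and the same word; only the place where it is divided varies.
  before-after : ∀ {gs : List (Ranking k)} (Gs : All (IsQ m) gs) l →
    word (before Gs l) ++ word (after Gs l) ≡ word (loops Gs)
  before-after (G ∷ Gs) zero    = refl
  before-after (G ∷ Gs) (suc l) = begin
    B ++ ((A ++ T) ++ U) ≡⟨ sym (++-assoc B (A ++ T) U) ⟩
    (B ++ (A ++ T)) ++ U ≡⟨ cong (_++ U) (sym (++-assoc B A T)) ⟩
    ((B ++ A) ++ T) ++ U ≡⟨ cong (λ w → (w ++ T) ++ U) (before-after Gs l) ⟩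
    (word (loops Gs) ++ T) ++ U ∎
    where
    open ≡-Reasoning
    A = word (after Gs l)
    B = word (before Gs l)
    T = word (connect f₀ _ F₀ G)
    U = word (connect _ f₀ G F₀)

  before-loops : ∀ {gs : List (Ranking k)} (Gs : All (IsQ m) gs) l →
    length (word (before Gs l)) ≤ length (word (loops Gs))
  before-loops Gs l = subst (length (word (before Gs l)) ≤_)
    (trans (sym (length-++ (word (before Gs l)))) (cong length (before-after Gs l)))
    (ℕ.m≤m+n _ (length (word (after Gs l))))

  before-antitone : ∀ {gs : List (Ranking k)} (Gs : All (IsQ m) gs) {i j} → i F.< j →
    length (word (before Gs j)) ≤ length (word (before Gs i))
  before-antitone (G ∷ Gs) {zero} {suc j} _ = ℕ.≤-trans (before-loops Gs j)
    (subst (length (word (loops Gs)) ≤_) (sym (length-++ (word (loops Gs)))) (ℕ.m≤m+n _ _))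
  before-antitone (G ∷ Gs) {suc i} {suc j} (s≤s lt) = before-antitone Gs lt

at-sweep : ∀ d w {o} → o < d → at (sweep d ++ w) o ≡ rotate
at-sweep (suc d) w {zero}  _        = refl
at-sweep (suc d) w {suc o} (s≤s lt) =
  trans (cong (λ u → at u o) (++-assoc (sweep d) (rotate⁻ ∷ []) w)) (at-sweep d (rotate⁻ ∷ w) lt)

-- Under rotations every thread passes through slot zero.
rotate-to-zero : ∀ {α} {σ : ℕ → St k} → Traces α σ → ∀ t d (p : Slot k) → toℕ p ≡ d → σ t ≡ slot p →
  (∀ o → o < d → α (t + o) ≡ rotate) → σ (t + d) ≡ slot zero
rotate-to-zero {σ = σ} R t zero zero e s S = trans (cong σ (ℕ.+-identityʳ t)) s
rotate-to-zero {α = α} {σ} R t (suc d) (suc p) e s S =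
  trans (cong σ (ℕ.+-suc t d))
    (rotate-to-zero {α = α} {σ} R (suc t) d (inject₁ p) (trans (Fin.toℕ-inject₁ p) (ℕ.suc-injective e))
      (rotate-fun (suc p) (σ (suc t)) (subst₂ (λ a s → Edge a s (σ (suc t)))
        (trans (cong α (sym (ℕ.+-identityʳ t))) (S 0 z<s)) s (R t)))
      (λ o lt → trans (cong α (sym (ℕ.+-suc t o))) (S (suc o) (s<s lt))))

module Arena {k m : ℕ} {f₀ : Ranking k} (F₀ : IsQ m f₀) {gs : List (Ranking k)} (Gs : All (IsQ m) gs) where

  open Blocks F₀ public

  opening : List Letter
  opening = sweep (suc (suc k))

  -- Both closings have two letters, so all blocks have the same length and block boundaries do not
  -- depend on β. The charge forces every thread through the final state and releases it at every
  -- slot.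
  closing : Bool → List Letter
  closing false = idle ∷ idle ∷ []
  closing true  = chargeIn ∷ chargeOut ∷ []

  block : Bool → List Letter
  block b = opening ++ (word (loops Gs) ++ closing b)

  period : ℕ
  period = length (block false)

  length-block : ∀ b → length (block b) ≡ period
  length-block false = refl
  length-block true  = trans (expand true) (sym (expand false))
    where
    length-closing : ∀ b → length (closing b) ≡ 2
    length-closing false = refl
    length-closing true  = refl
    expand : ∀ b → length (block b) ≡ length opening + (length (word (loops Gs)) + 2)
    expand b = trans (length-++ opening) (cong (length opening +_)
      (trans (length-++ (word (loops Gs))) (cong (length (word (loops Gs)) +_) (length-closing b))))

  letters : (ℕ → Bool) → ℕ → Letter
  letters β t = at (block (β (t / period))) (t % period)

  -- Changing β from some index on produces words that share a prescribed prefix.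
  letters-local : ∀ {β β′} t → (∀ i → i ≤ t → β i ≡ β′ i) → letters β t ≡ letters β′ t
  letters-local t e = cong (λ b → at (block b) (t % period)) (e (t / period) (ℕ.m/n≤m t period))

  div-block : ∀ i {o} → o < period → (i * period + o) / period ≡ i
  div-block i {o} lt = begin
    (i * period + o) / period          ≡⟨ ℕ.+-distrib-/-∣ˡ o (n∣m*n i) ⟩
    i * period / period + o / period   ≡⟨ cong₂ _+_ (ℕ.m*n/n≡m i period) (ℕ.m<n⇒m/n≡0 lt) ⟩
    i + 0                              ≡⟨ ℕ.+-identityʳ i ⟩
    i ∎
    where open ≡-Reasoning

  mod-block : ∀ i {o} → o < period → (i * period + o) % period ≡ o
  mod-block i {o} lt = trans (cong (_% period) (ℕ.+-comm (i * period) o))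
    (trans (ℕ.[m+kn]%n≡m%n o i period) (ℕ.m<n⇒m%n≡m lt))

  spells-block : ∀ β i → Spells (letters β) (i * period) (block (β i))
  spell (spells-block β i) o lt = cong₂ (λ j r → at (block (β j)) r) (div-block i lt′) (mod-block i lt′)
    where lt′ = subst (o <_) (length-block (β i)) lt

  private
    through-opening : ∀ {w p t b} → Path {k} w (slot p) t b → Path (opening ++ w) (slot p) t b
    through-opening π = complete (sweep-implements (suc (suc k))) (refl , refl) ++ᴾ π

  closing-path : ∀ b p → ∃ λ c → Path {k} (closing b) (slot p) (slot p) c
  closing-path false p = _ , _∷_ {t = slot p} refl (_∷_ {t = slot p} refl [])
  closing-path true  p = _ , _∷_ {t = final} _ (_∷_ {t = slot p} _ [])

  -- Levels are odd because links guarantee a path between equal ranks only if these are odd.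
  stay-level : ∀ b {p q j} → f₀ p ≡ odd j → f₀ q ≡ odd j → ∃ λ c → Path (block b) (slot p) (slot q) c
  stay-level b {q = q} {j} e e′ = _ , through-opening
    (proj₂ (keep (completeL (loops Gs)) _ _ j e e′) ++ᴾ proj₂ (closing-path b q))

  recharge : ∀ {p q j} → f₀ p ≡ odd j → Path (block true) (slot p) (slot q) true
  recharge {p} {q} {j} e with keep (completeL (loops Gs)) p p j e e
  ... | b , π = subst (Path _ _ _) (∨-zeroʳ b)
    (through-opening (π ++ᴾ (_∷_ {t = final} _ (_∷_ {t = slot q} _ []))))

  block-sound : Sound f₀ (block false) f₀
  block-sound = Sound-++ sweep-sound (Sound-++ (soundL (loops Gs)) idle-sound)
    where
    sweep-sound : Sound f₀ opening f₀
    bounds sweep-sound π with sound (sweep-implements (suc (suc k))) π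
    ... | q , e , refl , refl = q , e , ℕ.≤-refl , λ ()
    idle-sound : Sound f₀ (closing false) f₀
    bounds idle-sound (_∷_ {t = slot _} refl (_∷_ {t = slot q} refl [])) = q , refl , ℕ.≤-refl , λ ()

  block-slot : ∀ b {p s c} → Path {k} (block b) (slot p) s c → ∃ λ q → s ≡ slot q
  block-slot false π with bounds block-sound π
  ... | q , e , _ = q , e
  block-slot true π with split opening π
  ... | _ , _ , _ , π₁ , π₂ , _ with sound (sweep-implements (suc (suc k))) π₁
  ... | _ , refl , _ with split (word (loops Gs)) π₂
  ... | _ , _ , _ , π₃ , π₄ , _ with bounds (soundL (loops Gs)) π₃
  block-slot true π | _ , _ , _ , π₁ , π₂ , _ | _ , refl , _
    | _ , _ , _ , π₃ , (_∷_ {t = final} _ (_∷_ {t = slot q} _ [])) , _ | _ , refl , _ = q , refl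

  head : Fin (length gs) → List Letter
  head l = opening ++ word (before Gs l)

  back : Fin (length gs) → Bool → List Letter
  back l b = word (after Gs l) ++ closing b

  head-back : ∀ l b → head l ++ back l b ≡ block b
  head-back l b = trans (++-assoc opening B (A ++ closing b))
    (cong (opening ++_) (trans (sym (++-assoc B A (closing b))) (cong (_++ closing b) (before-after Gs l))))
    where
    A = word (after Gs l)
    B = word (before Gs l)

  cut : ℕ → Fin (length gs) → ℕ
  cut i l = i * period + length (head l)

  spells-head : ∀ β i l → Spells (letters β) (i * period) (head l)
  spells-head β i l = spells-++ˡ (head l)
    (subst (Spells (letters β) (i * period)) (sym (head-back l (β i))) (spells-block β i))

  spells-back : ∀ β i l → Spells (letters β) (cut i l) (back l (β i))
  spells-back β i l = spells-++ʳ (head l)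
    (subst (Spells (letters β) (i * period)) (sym (head-back l (β i))) (spells-block β i))

  cut-end : ∀ b i l → cut i l + length (back l b) ≡ suc i * period
  cut-end b i l = begin
    i * period + length (head l) + length (back l b)   ≡⟨ ℕ.+-assoc (i * period) (length (head l)) (length (back l b)) ⟩
    i * period + (length (head l) + length (back l b)) ≡⟨ cong (i * period +_) (sym (length-++ (head l) {back l b})) ⟩
    i * period + length (head l ++ back l b)           ≡⟨ cong (λ w → i * period + length w) (head-back l b) ⟩
    i * period + length (block b)                      ≡⟨ cong (i * period +_) (length-block b) ⟩
    i * period + period                                    ≡⟨ ℕ.+-comm (i * period) period ⟩
    suc i * period ∎
    where open ≡-Reasoning

  block-end : ∀ b i → i * period + length (block b) ≡ suc i * period
  block-end b i = trans (cong (i * period +_) (length-block b)) (ℕ.+-comm (i * period) period)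

  start<cut : ∀ i l → i * period < cut i l
  start<cut i l = ℕ.m<m+n (i * period) z<s

  cut≤end : ∀ i l → cut i l ≤ suc i * period
  cut≤end i l = subst (cut i l ≤_) (cut-end false i l) (ℕ.m≤m+n (cut i l) (length (back l false)))

  cut-antitone : ∀ i {l l′} → l F.< l′ → cut i l′ ≤ cut i l
  cut-antitone i {l} {l′} lt = ℕ.+-monoʳ-≤ (i * period) (subst₂ _≤_ (sym (length-++ opening {word (before Gs l′)})) (sym (length-++ opening {word (before Gs l)}))
    (ℕ.+-monoʳ-≤ (length opening) (before-antitone Gs lt)))

  -- Paired with `back-path`: a thread goes from its level to a slot of no larger rank at one cut,
  -- and from a slot of no smaller rank at another cut back to its level. Strictness on one side is
  -- enough for a visit to the final state.
  head-path : ∀ l {p q j} → f₀ p ≡ odd j → lookup gs l q ≤ odd j → ∃ λ b → Path (head l) (slot p) (slot q) b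
    × (lookup gs l q < odd j → b ≡ true)
  head-path l {p} {q} {j} e le with lookup gs l q ℕ.≟ odd j
  ... | yes e′ with keep (completeL (before Gs l)) p q j e e′
  ...   | b , π = b , through-opening π , λ lt → contradiction lt (ℕ.<-irrefl e′)
  head-path l {p} {q} {j} e le | no ne = true , through-opening
    (descend (completeL (before Gs l)) p q (subst (lookup gs l q <_) (sym e) (ℕ.≤∧≢⇒< le ne))) , λ _ → refl

  back-path : ∀ l c {p q j} → f₀ q ≡ odd j → odd j ≤ lookup gs l p → ∃ λ b → Path (back l c) (slot p) (slot q) b
    × (odd j < lookup gs l p → b ≡ true)
  back-path l c {p} {q} {j} e le with lookup gs l p ℕ.≟ odd j
  ... | yes e′ with keep (completeL (after Gs l)) p q j e′ e | closing-path c q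
  ...   | b , π | b′ , π′ = b ∨ b′ , π ++ᴾ π′ , λ lt → contradiction lt (ℕ.<-irrefl (sym e′))
  back-path l c {p} {q} {j} e le | no ne with closing-path c q
  ...   | b′ , π′ = true , descend (completeL (after Gs l)) p q (subst (_< lookup gs l p) (sym e)
    (ℕ.≤∧≢⇒< le (ne ∘ sym))) ++ᴾ π′ , λ _ → refl

  module _ (β : ℕ → Bool) (σ : ℕ → St k) (R : Traces (letters β) σ) (σ₀ : ∃ λ p → σ 0 ≡ slot p) where

    private
      over : ∀ i {p} → σ (i * period) ≡ slot p → ∃ λ b → Path (block (β i)) (slot p) (σ (suc i * period)) b
        × (∀ o → o < period → σ (i * period + o) ≡ final → b ≡ true)
      over i e with trace-path {α = letters β} {σ} R (block (β i)) (i * period) (spells-block β i)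
      ... | b , π , v = b , subst₂ (λ s t → Path (block (β i)) s (σ t) b) e (block-end (β i) i) π ,
        λ o lt → v o (subst (o <_) (sym (length-block (β i))) lt)

    slot-at-start : ∀ i → ∃ λ p → σ (i * period) ≡ slot p
    slot-at-start zero = σ₀
    slot-at-start (suc i) with slot-at-start i
    ... | p , e = block-slot (β i) (proj₁ (proj₂ (over i e)))

    slot-zero-recurs : ∀ i → ∃ λ t → i ≤ t × σ t ≡ slot zero
    slot-zero-recurs i with slot-at-start i
    ... | p , e = i * period + toℕ p , ℕ.≤-trans (ℕ.m≤m*n i period) (ℕ.m≤m+n _ (toℕ p)) ,
      rotate-to-zero {α = letters β} {σ} R (i * period) (toℕ p) p refl e
        (λ o lt → trans (spell (spells-block β i) o (subst (o <_) (sym (length-block (β i)))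
            (ℕ.<-≤-trans (ℕ.<-trans lt (Fin.toℕ<n p)) opening≤)))
          (at-sweep (suc (suc k)) _ (ℕ.<-trans lt (Fin.toℕ<n p))))
      where
      sweep-long : ∀ d → d ≤ length (sweep d)
      sweep-long zero = z≤n
      sweep-long (suc d) = s≤s (ℕ.≤-trans (sweep-long d)
        (subst (length (sweep d) ≤_) (sym (length-++ (sweep d))) (ℕ.m≤m+n _ _)))
      opening≤ : suc (suc k) ≤ period
      opening≤ = ℕ.≤-trans (sweep-long (suc (suc k)))
        (subst (length opening ≤_) (sym (length-++ opening)) (ℕ.m≤m+n _ _))

    private
      -- Only blocks without recharge keep the rank from rising, so β is inspected block by block; a
      -- recharge is thereby found together with its index.
      scan : ∀ n i {p} → σ (i * period) ≡ slot p →
        (∃ λ j → i ≤ j × β j ≡ true) ⊎ (∃ λ q → σ ((n + i) * period) ≡ slot q × f₀ q ≤ f₀ p)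
      scan zero i {p} e = inj₂ (p , e , ℕ.≤-refl)
      scan (suc n) i e with scan n i e
      ... | inj₁ r = inj₁ r
      ... | inj₂ (q , e′ , le) with β (n + i) in eq | over (n + i) e′
      ...   | true  | _ = inj₁ (n + i , ℕ.m≤n+m i n , eq)
      ...   | false | b , π , _ with bounds block-sound π
      ...     | r , e″ , le′ , _ = inj₂ (r , e″ , ℕ.≤-trans le′ le)

    -- Between two recharges the rank bounds the number of visits to the final state.
    final-recurs⇒recharges : (∀ i → ∃ λ t → i ≤ t × σ t ≡ final) → Inf β
    final-recurs⇒recharges V i with slot-at-start i
    ... | p , e = bounded-rank (suc (f₀ p)) i e ℕ.≤-refl
      where
      bounded-rank : ∀ r i {p} → σ (i * period) ≡ slot p → f₀ p < r → ∃ λ j → i ≤ j × β j ≡ true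
      bounded-rank (suc r) i {p} e lt with V (i * period)
      ... | t , i≤t , fin = go (ℕ.m/n*n≤m t period) (ℕ.m≡m%n+[m/n]*n t period)
        where
        j = t / period
        i≤j : i ≤ j
        i≤j = subst (_≤ j) (ℕ.m*n/n≡m i period) (ℕ./-monoˡ-≤ period i≤t)
        go : j * period ≤ t → t ≡ t % period + j * period → ∃ λ j → i ≤ j × β j ≡ true
        go _ t≡ with scan (j ∸ i) i e
        ... | inj₁ r = r
        ... | inj₂ (q , e′ , le) with subst (λ n → σ (n * period) ≡ slot q) (ℕ.m∸n+n≡m i≤j) e′
        ...   | e″ with β j in eq | over j e″
        ...     | true | _ = j , i≤j , eq
        ...     | false | b , π , v with bounds block-sound π
        -- The visit lies in the uncharged block j, so the rank at its end is below `f₀ q`, which is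
        -- at most `f₀ p`; the bound falls from `suc r` to `r`.
        ...       | s , e‴ , _ , strict with bounded-rank r (suc j) e‴
          (ℕ.<-≤-trans (strict (v (t % period) (ℕ.m%n<n t period)
            (trans (cong σ (trans (ℕ.+-comm (j * period) (t % period)) (sym t≡))) fin))) (ℕ.≤-trans le (ℕ.≤-pred lt)))
        ...         | j′ , le′ , tr = j′ , ℕ.≤-trans i≤j (ℕ.≤-trans (ℕ.n≤1+n j) le′) , tr

-- Scheduling the levels of a thread

¬¬-all : ∀ {n} {P : Fin n → Set} → (∀ i → ¬ ¬ P i) → ¬ ¬ (∀ i → P i)
¬¬-all = Fin.sequence (RawMonad.rawApplicative ¬¬-Monad)

rot^ : ∀ {n} → ℕ → Fin (suc n) → Fin (suc n)
rot^ zero    c = c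
rot^ (suc d) c = rot^ d (rot c)

rot^-+ : ∀ {n} d e (c : Fin (suc n)) → rot^ (d + e) c ≡ rot^ e (rot^ d c)
rot^-+ zero    e c = refl
rot^-+ (suc d) e c = rot^-+ d e (rot c)

rot-descends : ∀ {n} d (c q : Fin (suc n)) → toℕ c ≡ d + toℕ q → rot^ d c ≡ q
rot-descends zero    c       q e = Fin.toℕ-injective e
rot-descends (suc d) (suc c) q e = rot-descends d (inject₁ c) q (trans (Fin.toℕ-inject₁ c) (ℕ.suc-injective e))

rot-transitive : ∀ {n} (c q : Fin (suc n)) → ∃ λ d → rot^ d c ≡ q
-- `toℕ c` steps lead down to zero, one more wraps around to `fromℕ n`, and the others descend to
-- `q`.
rot-transitive {n} c q = toℕ c + suc (n ∸ toℕ q) ,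
  trans (rot^-+ (toℕ c) (suc (n ∸ toℕ q)) c)
    (trans (cong (rot^ (suc (n ∸ toℕ q))) (rot-descends (toℕ c) c zero (sym (ℕ.+-identityʳ (toℕ c)))))
      (rot-descends (n ∸ toℕ q) (fromℕ n) q
        (trans (Fin.toℕ-fromℕ n) (sym (ℕ.m∸n+n≡m (ℕ.≤-pred (Fin.toℕ<n q)))))))

-- In the application, `level i` is the level on which block i offers a visit to the final state,
-- and `S q i` says that state q of `B` occurs in block i. A switch visits the final state too, but
-- rereads distant blocks. By `harmless`, switches can go on forever only if every q recurs anyway;
-- `late` defers them until suitable detours exist.
record Schedule {m n} (T₀ : ℕ) (level : ℕ → Fin m) (S : Fin n → ℕ → Bool) : Set where
  field
    choice   : ℕ → Fin m
    switch   : ℕ → Bool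
    stable   : ∀ i → switch i ≡ false → choice (suc i) ≡ choice i
    late     : ∀ i → switch i ≡ true → T₀ ≤ i
    progress : ∀ i → ∃ λ j → i ≤ j × (level j ≡ choice j ⊎ switch j ≡ true)
    harmless : ∀ q → (∀ i → ∃ λ j → i ≤ j × (S q j ≡ true ⊎ switch j ≡ true)) → Inf (S q)

constant : ∀ {m n T₀} {level : ℕ → Fin m} {S : Fin n → ℕ → Bool} v →
  (∀ i → ∃ λ j → i ≤ j × level j ≡ v) → Schedule T₀ level S
constant v V = record
  { choice = λ _ → v ; switch = λ _ → false ; stable = λ _ _ → refl ; late = λ _ ()
  ; progress = λ i → let j , le , e = V i in j , le , inj₁ e
  ; harmless = λ q E i → let j , le , e = E i in j , le , [ id , (λ ()) ]′ e }

-- A round robin over the n modes. In mode q the level v q is used until the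
-- event M q happens; M q contains S q, occurs infinitely often only if S q does, and until it
-- happens the level v q keeps coming. So a window without M q contains at most n switches.
module _ {m n : ℕ} (T₀ : ℕ) (level : ℕ → Fin m) (S : Fin (suc n) → ℕ → Bool) where

  record Mode (q : Fin (suc n)) : Set where
    field
      M        : ℕ → Bool
      v        : Fin m
      contains : ∀ i → S q i ≡ true → M i ≡ true
      rare     : Inf (S q) ⊎ ¬ Inf M
      served   : ∀ i → ∃ λ j → i ≤ j × (M j ≡ true ⊎ level j ≡ v)
  open Mode

  -- M is S q together with the levels below the least j for which adding level j makes it recur.
  mode : ∀ q → ¬ ¬ Mode q
  mode q none = ¬¬-excluded-middle {A = Inf (S q)} λ
    -- If `S q` recurs, nothing has to be avoided for q: the mode may end at once, and its level is
    -- arbitrary.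
    { (yes inf) → none record
        { M = λ _ → true ; v = level 0 ; contains = λ _ _ → refl ; rare = inj₁ inf
        ; served = λ i → i , ℕ.≤-refl , inj₁ refl }
    ; (no ¬inf) → search m 0 (ℕ.+-identityʳ m) λ inf → ¬inf λ i → let j , le , e = inf i in j , le , base j e }
    where
    below : ℕ → ℕ → Bool
    below j i = S q i ∨ (toℕ (level i) <ᵇ j)
    base : ∀ i → below 0 i ≡ true → S q i ≡ true
    base i e with S q i
    base i e | true  = refl
    base i () | false
    grows : ∀ j i → below (suc j) i ≡ true → below j i ≡ true ⊎ toℕ (level i) ≡ j
    grows j i e with S q i
    ... | true = inj₁ refl
    ... | false with toℕ (level i) <? j
    ...   | yes lt = inj₁ (Equivalence.to T-≡ (ℕ.<⇒<ᵇ lt))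
    ...   | no nlt = inj₂ (ℕ.≤-antisym (ℕ.≤-pred (ℕ.<ᵇ⇒< _ _ (Equivalence.from T-≡ e))) (ℕ.≮⇒≥ nlt))
    full : Inf (below m)
    full i = i , ℕ.≤-refl , trans (cong (S q i ∨_) (Equivalence.to T-≡ (ℕ.<⇒<ᵇ (Fin.toℕ<n (level i))))) (∨-zeroʳ (S q i))
    search : ∀ d j → d + j ≡ m → ¬ Inf (below j) → ⊥
    search zero    j refl ¬inf = ¬inf full
    search (suc d) j e    ¬inf = ¬¬-excluded-middle {A = Inf (below (suc j))} λ
      { (yes inf) → none record
          { M = below j ; v = fromℕ< j<m
          ; contains = λ i s → cong (_∨ (toℕ (level i) <ᵇ j)) s
          ; rare = inj₂ ¬inf
          ; served = λ i → let i′ , le , s = inf i in i′ , le ,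
              [ inj₁ , (λ e′ → inj₂ (Fin.toℕ-injective (trans e′ (sym (Fin.toℕ-fromℕ< j<m))))) ]′ (grows j i′ s) }
      ; (no ¬inf′) → search d (suc j) (trans (ℕ.+-suc d j) e) ¬inf′ }
      where
      j<m : j < m
      j<m = subst (j <_) e (s≤s (ℕ.m≤n+m j d))

  module RoundRobin (modes : ∀ q → Mode q) where

    happens : Fin (suc n) → ℕ → Bool
    happens c i = (T₀ ≤ᵇ i) ∧ M (modes c) i

    current : ℕ → Fin (suc n)
    current zero    = zero
    current (suc i) = if happens (current i) i then rot (current i) else current i

    switched : ℕ → Bool
    switched i = happens (current i) i

    switched-current : ∀ i → switched i ≡ true → current (suc i) ≡ rot (current i)
    switched-current i e rewrite e = refl

    stays-current : ∀ i → switched i ≡ false → current (suc i) ≡ current i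
    stays-current i e rewrite e = refl

    happens-late : ∀ c i → happens c i ≡ true → T₀ ≤ i × M (modes c) i ≡ true
    happens-late c i e with T₀ ≤ᵇ i in eq
    ... | true = ℕ.≤ᵇ⇒≤ T₀ i (Equivalence.from T-≡ eq) , e

    late-happens : ∀ c i → T₀ ≤ i → M (modes c) i ≡ true → happens c i ≡ true
    late-happens c i p e rewrite Equivalence.to T-≡ (ℕ.≤⇒≤ᵇ p) = e

    first-switch : ∀ d i → (∃ λ j → i ≤ j × current j ≡ current i × switched j ≡ true) ⊎ current (d + i) ≡ current i
    first-switch zero i = inj₂ refl
    first-switch (suc d) i with first-switch d i
    ... | inj₁ r = inj₁ r
    ... | inj₂ e with switched (d + i) in eq
    ...   | true  = inj₁ (d + i , ℕ.m≤n+m i d , e , eq)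
    ...   | false = inj₂ e

    -- `d` counts the switches until mode q is current. An occurrence of `S q` on the way is already
    -- an event of q; otherwise switches continue until mode q itself is left, which takes such an
    -- event.
    recurs : ∀ q → (∀ i → ∃ λ j → i ≤ j × (S q j ≡ true ⊎ switched j ≡ true)) →
      ∀ d i → rot^ d (current i) ≡ q → ∃ λ j → i ≤ j × M (modes q) j ≡ true
    recurs q E d i e with E i
    ... | j , i≤j , ev with first-switch (j ∸ i) i | d
    ...   | inj₁ (j′ , i≤j′ , e′ , s) | zero =
      j′ , i≤j′ , subst (λ c → M (modes c) j′ ≡ true) (trans e′ e) (proj₂ (happens-late _ j′ s))
    ...   | inj₁ (j′ , i≤j′ , e′ , s) | suc d
      with recurs q E d (suc j′) (trans (cong (rot^ d) (trans (switched-current j′ s) (cong rot e′))) e)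
    ...     | j″ , le , r = j″ , ℕ.≤-trans i≤j′ (ℕ.≤-trans (ℕ.n≤1+n j′) le) , r
    recurs q E d i e | j , i≤j , inj₁ s | inj₂ _ | _ = j , i≤j , contains (modes q) j s
    recurs q E d i e | j , i≤j , inj₂ s | inj₂ e′ | zero =
      j , i≤j , subst (λ c → M (modes c) j ≡ true)
        (trans (trans (cong current (sym (ℕ.m∸n+n≡m i≤j))) e′) e) (proj₂ (happens-late _ j s))
    recurs q E d i e | j , i≤j , inj₂ s | inj₂ e′ | suc d′
      with recurs q E d′ (suc j) (trans (cong (rot^ d′) (trans (switched-current j s)
             (cong rot (trans (cong current (sym (ℕ.m∸n+n≡m i≤j))) e′)))) e)
    ... | j″ , le , r = j″ , ℕ.≤-trans i≤j (ℕ.≤-trans (ℕ.n≤1+n j) le) , r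

    round-robin : Schedule T₀ level S
    round-robin = record
      { choice = v ∘ modes ∘ current ; switch = switched
      ; stable = λ i e → cong (v ∘ modes) (stays-current i e)
      ; late = λ i e → proj₁ (happens-late _ i e)
      ; progress = prog ; harmless = harm }
      where
      harm : ∀ q → _ → Inf (S q)
      harm q E with rare (modes q)
      ... | inj₁ inf = inf
      ... | inj₂ ¬inf = contradiction (λ i → let d , e = rot-transitive (current i) q in recurs q E d i e) ¬inf
      prog : ∀ i → ∃ λ j → i ≤ j × (level j ≡ v (modes (current j)) ⊎ switched j ≡ true)
      prog i with served (modes (current (T₀ + i))) (T₀ + i)
      ... | j , le , ev with first-switch (j ∸ (T₀ + i)) (T₀ + i)
      ...   | inj₁ (j′ , le′ , _ , s) = j′ , ℕ.≤-trans (ℕ.m≤n+m i T₀) le′ , inj₂ s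
      ...   | inj₂ e with trans (cong current (sym (ℕ.m∸n+n≡m le))) e
      ...     | e′ = j , ℕ.≤-trans (ℕ.m≤n+m i T₀) le ,
        -- From T₀ on, an event of the current mode is itself a switch.
        [ (λ s → inj₂ (late-happens (current j) j (ℕ.≤-trans (ℕ.m≤m+n T₀ i) le)
                   (subst (λ c → M (modes c) j ≡ true) (sym e′) s)))
        , (λ l → inj₁ (trans l (cong (v ∘ modes) (sym e′)))) ] ev

  schedule : ¬ ¬ Schedule T₀ level S
  schedule none = ¬¬-all mode λ modes → none (RoundRobin.round-robin modes)

-- Rearranging a run

Incomparable : List (Ranking k) → Set
Incomparable gs = ∀ i j → i F.< j → ∃ λ p → lookup gs i p < lookup gs j p

does-true : ∀ {A : Set} (d : Dec A) → does d ≡ true → A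
does-true (yes a) _ = a

module Pump {k m : ℕ} {f₀ : Ranking k} (F₀ : IsQ m f₀) {gs : List (Ranking k)} (Gs : All (IsQ m) gs) where

  open Arena F₀ Gs public

  rep : Fin m → Slot k
  rep v = proj₁ (attains F₀ (toℕ v) (Fin.toℕ<n v))

  rep-odd : ∀ v → f₀ (rep v) ≡ odd (toℕ v)
  rep-odd v = proj₂ (attains F₀ (toℕ v) (Fin.toℕ<n v))

  thread : Fin m → St k
  thread v = slot (rep v)

  block-of : ∀ i {p} → i * period ≤ p → i ≤ p / period
  block-of i {p} le = subst (_≤ p / period) (ℕ.m*n/n≡m i period) (ℕ./-monoˡ-≤ period le)

  block-start≤ : ∀ p → p / period * period ≤ p
  block-start≤ p = ℕ.m/n*n≤m p period

  <block-end : ∀ p → p < suc (p / period) * period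
  <block-end p = subst (_< suc (p / period) * period) (sym (ℕ.m≡m%n+[m/n]*n p period))
    (ℕ.+-monoˡ-< (p / period * period) (ℕ.m%n<n p period))

  i≤start : ∀ i → i ≤ i * period
  i≤start i = ℕ.m≤m*n i period

  module Walks {Y : Set} (β : ℕ → Bool) (ρ : ℕ → Y) where

    open Jumps {k} (letters β) ρ public

    block-seg : ∀ i {s t b} → Path (block (β i)) s t b → Seg (i * period) (suc i * period) s t b
    block-seg i {s} {t} {b} π = subst (λ n → Seg (i * period) n s t b) (block-end (β i) i)
      (path-seg (i * period) (spells-block β i) π)

    stay-seg : ∀ i v → ∃ λ b → Seg (i * period) (suc i * period) (thread v) (thread v) b
    stay-seg i v with stay-level (β i) {j = toℕ v} (rep-odd v) (rep-odd v)
    ... | b , π = b , block-seg i π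

    recharge-seg : ∀ i v w → β i ≡ true → Seg (i * period) (suc i * period) (thread v) (thread w) true
    recharge-seg i v w e = block-seg i (subst (λ b → Path (block b) (thread v) (thread w) true) (sym e)
      (recharge {q = rep w} {j = toℕ v} (rep-odd v)))

    start-mono : ∀ {i j} → i ≤ j → i * period ≤ j * period
    start-mono = ℕ.*-monoˡ-≤ period

    stay-segs : ∀ d i v → ∃ λ b → Seg (i * period) ((d + i) * period) (thread v) (thread v) b
    stay-segs zero    i v = false , empty-seg
    stay-segs (suc d) i v with stay-segs d i v | stay-seg (d + i) v
    ... | b , T | c , U = b ∨ c , _++ˢ_ T U {start-mono (ℕ.m≤n+m i d)} {start-mono (ℕ.n≤1+n (d + i))}

    lift-seg : ∀ a d c v w → a ≤ d → d < c → β d ≡ true → Seg (a * period) (c * period) (thread v) (thread w) true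
    lift-seg a d c v w a≤d d<c e with stay-segs (d ∸ a) a v | stay-segs (c ∸ suc d) (suc d) w
    ... | b , T | b′ , U rewrite ℕ.m∸n+n≡m a≤d | ℕ.m∸n+n≡m d<c =
      subst (Seg (a * period) (c * period) (thread v) (thread w)) (∨-zeroʳ b)
        (_++ˢ_ T (_++ˢ_ (recharge-seg d v w e) U {start-mono (ℕ.n≤1+n d)} {start-mono d<c})
          {start-mono a≤d} {start-mono (ℕ.<⇒≤ d<c)})

  module _ {n : ℕ} (β : ℕ → Bool) (ρ : ℕ → Fin n) where

    open Walks β ρ

    -- The loop of ρ between the two cuts leads from slot p at the later cut back to
    -- slot p at the earlier one, whose rank there is larger.
    record Gadget (i : ℕ) (v : Fin m) : Set where
      field
        {early late-cut} : Fin (length gs)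
        p      : Slot k
        order  : cut i early ≤ cut i late-cut
        same   : ρ (cut i late-cut) ≡ ρ (cut i early)
        lower  : lookup gs late-cut p ≤ odd (toℕ v)
        upper  : odd (toℕ v) ≤ lookup gs early p
        strict : lookup gs late-cut p < odd (toℕ v) ⊎ odd (toℕ v) < lookup gs early p

    -- A block has more cuts than `B` has states, so two cuts carry the same state. As the ranks of
    -- p there differ, an odd level fits between them: the lower rank if it is odd, its successor
    -- otherwise.
    gadget : n < length gs → Incomparable gs → ∀ i → ∃ (Gadget i)
    gadget n<L inc i with Fin.pigeonhole n<L (λ l → ρ (cut i l))
    ... | l , l′ , l<l′ , e with inc l l′ l<l′
    ... | p , lt with even-or-odd (lookup gs l p)
    ...   | j , inj₁ ev = v , record
      { p = p ; order = cut-antitone i l<l′ ; same = e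
      ; lower = subst₂ _≤_ (sym ev) (sym ov) (ℕ.n≤1+n _)
      ; upper = subst (_≤ lookup gs l′ p) (sym ov) (subst (_< lookup gs l′ p) ev lt)
      ; strict = inj₁ (subst₂ _<_ (sym ev) (sym ov) (ℕ.n<1+n _)) }
      where
      j<m : j < m
      j<m = double<⇒< (ℕ.<-trans (subst (_< lookup gs l′ p) ev lt) (bounded (lookupQ Gs l′) p))
      v = fromℕ< j<m
      ov : odd (toℕ v) ≡ odd j
      ov = cong odd (Fin.toℕ-fromℕ< j<m)
    ...   | j , inj₂ od = v , record
      { p = p ; order = cut-antitone i l<l′ ; same = e
      ; lower = ℕ.≤-reflexive (trans od (sym ov))
      ; upper = ℕ.<⇒≤ lt′
      ; strict = inj₂ lt′ }
      where
      j<m : j < m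
      j<m = double<⇒< (ℕ.<-trans (ℕ.n<1+n _) (subst (_< m + m) od (bounded (lookupQ Gs l) p)))
      v = fromℕ< j<m
      ov : odd (toℕ v) ≡ odd j
      ov = cong odd (Fin.toℕ-fromℕ< j<m)
      lt′ : odd (toℕ v) < lookup gs l′ p
      lt′ = subst (_< lookup gs l′ p) (trans od (sym ov)) lt

    -- A loop of ρ at r that reads the recharged block d and so lets a thread change its level. Its
    -- blocks may be far from the current one, which is why switches need `harmless`.
    record Detour (r : Fin n) : Set where
      field
        {a d c} : ℕ
        a≤d    : a ≤ d
        d<c    : d < c
        charge : β d ≡ true
        leave  : r ≡ ρ (a * period)
        return : ρ (c * period) ≡ r

    at? : ∀ q i → Dec (∃ λ (o : Fin period) → ρ (i * period + toℕ o) ≡ q)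
    at? q i = Fin.any? λ o → ρ (i * period + toℕ o) Fin.≟ q

    state-at : Fin n → ℕ → Bool
    state-at q i = does (at? q i)

    state-at-intro : ∀ {q p} i → i * period ≤ p → p < suc i * period → ρ p ≡ q → state-at q i ≡ true
    state-at-intro {q} {p} i le lt e = dec-true (at? q i) (fromℕ< o<N ,
      trans (cong ρ (trans (cong (i * period +_) (Fin.toℕ-fromℕ< o<N)) (ℕ.m+[n∸m]≡n le))) e)
      where
      o<N : p ∸ i * period < period
      o<N = ℕ.+-cancelˡ-< (i * period) _ _ (subst₂ _<_ (sym (ℕ.m+[n∸m]≡n le)) (ℕ.+-comm period (i * period)) lt)

    state-at-elim : ∀ {q} i → state-at q i ≡ true → ∃ λ p → i ≤ p × ρ p ≡ q
    state-at-elim {q} i e with does-true (at? q i) e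
    ... | o , eq = i * period + toℕ o , ℕ.≤-trans (i≤start i) (ℕ.m≤m+n _ _) , eq

    module Pumped {T₀ : ℕ} (gadgets : ∀ i → ∃ (Gadget i)) (sch : Schedule T₀ (proj₁ ∘ gadgets) state-at)
      (detours : ∀ i → Schedule.switch sch i ≡ true → Detour (ρ (suc i * period))) where

      open Schedule sch

      -- The exception in `within` accounts for the detour of a switch, the only part that may read
      -- outside block i.
      record Stage (i : ℕ) : Set where
        field
          list   : List (ℕ × St k)
          chain  : Chain _↝_ (i * period , thread (choice i)) list (suc i * period , thread (choice (suc i)))
          some   : 0 < length list
          covers : ∀ {p} → i * period ≤ p → p < suc i * period → ∃ λ r → (p , r) ∈ list
          within : ∀ {p r} → (p , r) ∈ list → (i * period ≤ p × p < suc i * period) ⊎ switch i ≡ true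
          hits   : (proj₁ (gadgets i) ≡ choice i ⊎ switch i ≡ true) → ∃ λ p → (p , final) ∈ list

      start< : ∀ i → i * period < suc i * period
      start< i = ℕ.m<n+m (i * period) z<s

      retarget : ∀ i {x l t} → switch i ≡ false → Chain _↝_ x l (t , thread (choice i)) →
        Chain _↝_ x l (t , thread (choice (suc i)))
      retarget i {x} {l} {t} sw = subst (λ v → Chain _↝_ x l (t , thread v)) (sym (stable i sw))

      plain : ∀ i → switch i ≡ false → proj₁ (gadgets i) ≢ choice i → Stage i
      plain i sw ne with stay-seg i (choice i)
      ... | b , T = record
        { list = Seg.list T
        ; chain = retarget i sw (Seg.chain T)
        ; some = seg-length (start< i) T
        ; covers = Seg.covers T
        ; within = inj₁ ∘ Seg.within T
        ; hits = [ (λ e → contradiction e ne) , (λ e → contradiction (trans (sym e) sw) λ ()) ]′ }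

      gain : ∀ i → switch i ≡ false → proj₁ (gadgets i) ≡ choice i → Stage i
      gain i sw e with head-path late-cut {p = rep (choice i)} {q = p} {j = toℕ (choice i)} (rep-odd (choice i)) lower′
                     | back-path early (β i) {p = p} {q = rep (choice i)} {j = toℕ (choice i)} (rep-odd (choice i)) upper′
        where
        open Gadget (subst (Gadget i) e (proj₂ (gadgets i))) renaming (lower to lower′; upper to upper′)
      ... | b , π , st | b′ , π′ , st′ = record
        { list = Seg.list T ++ Seg.list U
        -- From the later cut the walk jumps back to the earlier one, so the part between the cuts
        -- is read twice.
        ; chain = land same (seg-length (start<cut i late-cut) T) (Seg.chain T) ++ᶜ
                  retarget i sw (Seg.chain U)
        ; some = ℕ.<-≤-trans (seg-length (start<cut i late-cut) T)
            (subst (length (Seg.list T) ≤_) (sym (length-++ (Seg.list T))) (ℕ.m≤m+n _ _))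
        ; covers = cov
        ; within = λ m → inj₁ ([ wT , wU ]′ (∈-++⁻ (Seg.list T) m))
        ; hits = λ _ → hit }
        where
        open Gadget (subst (Gadget i) e (proj₂ (gadgets i)))
        T : Seg (i * period) (cut i late-cut) (thread (choice i)) (slot p) b
        T = path-seg (i * period) (spells-head β i late-cut) π
        U : Seg (cut i early) (suc i * period) (slot p) (thread (choice i)) b′
        U = subst (λ n → Seg (cut i early) n (slot p) (thread (choice i)) b′) (cut-end (β i) i early)
          (path-seg (cut i early) (spells-back β i early) π′)
        cov : ∀ {q} → i * period ≤ q → q < suc i * period → ∃ λ r → (q , r) ∈ Seg.list T ++ Seg.list U
        cov {q} le lt with q ℕ.<? cut i late-cut
        ... | yes lt′ = let r , m = Seg.covers T le lt′ in r , ∈-++⁺ˡ m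
        ... | no ge   = let r , m = Seg.covers U (ℕ.≤-trans order (ℕ.≮⇒≥ ge)) lt in r , ∈-++⁺ʳ (Seg.list T) m
        wT : ∀ {q r} → (q , r) ∈ Seg.list T → i * period ≤ q × q < suc i * period
        wT m = let l , u = Seg.within T m in l , ℕ.<-≤-trans u (cut≤end i late-cut)
        wU : ∀ {q r} → (q , r) ∈ Seg.list U → i * period ≤ q × q < suc i * period
        wU m = let l , u = Seg.within U m in ℕ.≤-trans (ℕ.<⇒≤ (start<cut i early)) l , u
        hit : ∃ λ q → (q , final) ∈ Seg.list T ++ Seg.list U
        hit with strict
        ... | inj₁ lt = let q , m = Seg.hits T (st lt) in q , ∈-++⁺ˡ m
        ... | inj₂ lt = let q , m = Seg.hits U (st′ lt) in q , ∈-++⁺ʳ (Seg.list T) m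

      change : ∀ i → switch i ≡ true → Stage i
      change i sw with stay-seg i (choice i)
      ... | b , T = record
        { list = Seg.list T ++ Seg.list D
        -- After block i the walk runs once through the loop of the detour, whose recharge exchanges
        -- the level, and returns to the end of block i.
        ; chain = land leave (seg-length (start< i) T) (Seg.chain T) ++ᶜ
                  land return (seg-length (ℕ.*-monoˡ-< period (ℕ.≤-<-trans a≤d d<c)) D) (Seg.chain D)
        ; some = ℕ.<-≤-trans (seg-length (start< i) T)
            (subst (length (Seg.list T) ≤_) (sym (length-++ (Seg.list T))) (ℕ.m≤m+n _ _))
        ; covers = λ le lt → let r , m = Seg.covers T le lt in r , ∈-++⁺ˡ m
        ; within = λ _ → inj₂ sw
        ; hits = λ _ → let q , m = Seg.hits D refl in q , ∈-++⁺ʳ (Seg.list T) m }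
        where
        open Detour (detours i sw)
        D = lift-seg a d c (choice i) (choice (suc i)) a≤d d<c charge

      stages : ∀ i → Stage i
      stages i with switch i in sw
      ... | true = change i sw
      ... | false with proj₁ (gadgets i) Fin.≟ choice i
      ...   | yes e = gain i sw e
      ...   | no ne = plain i sw ne

      open Concat (λ i → i * period , thread (choice i)) (Stage.list ∘ stages) (Stage.chain ∘ stages) (Stage.some ∘ stages)

      φ : ℕ → ℕ
      φ = proj₁ ∘ seq

      σ : ℕ → St k
      σ = proj₂ ∘ seq

      φ-start : φ 0 ≡ 0
      φ-start = cong proj₁ seq-start

      σ-start : ∃ λ p → σ 0 ≡ slot p
      σ-start = _ , cong proj₂ seq-start

      ρ-step : ∀ j → ρ (suc (φ j)) ≡ ρ (φ (suc j))
      ρ-step j = proj₁ (seq-edge j)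

      σ-traces : Traces (letters β ∘ φ) σ
      σ-traces j = proj₂ (seq-edge j)

      final-recurs : InfOcc σ final
      final-recurs i with progress i
      ... | j , i≤j , ev with Stage.hits (stages j) ev
      ... | p , m with visits m
      ... | t , j≤t , e = t , ℕ.≤-trans i≤j j≤t , cong proj₂ e

      same-recurring : ∀ q → InfOcc ρ q ⇔ InfOcc (ρ ∘ φ) q
      same-recurring q = mk⇔ to from
        where
        to : InfOcc ρ q → InfOcc (ρ ∘ φ) q
        to V i with V (i * period)
        ... | p , le , e with Stage.covers (stages (p / period)) (block-start≤ p) (<block-end p)
        ... | r , m with visits m
        ... | t , j≤t , e′ = t , ℕ.≤-trans (block-of i le) j≤t , trans (cong (ρ ∘ proj₁) e′) e
        from : InfOcc (ρ ∘ φ) q → InfOcc ρ q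
        -- A late occurrence of q in the rearranged run lies in the block of its stage or belongs to
        -- a switch, which is just the premise of `harmless`.
        from V i with harmless q ev i
          where
          ev : ∀ i → ∃ λ j → i ≤ j × (state-at q j ≡ true ⊎ switch j ≡ true)
          ev i with eventually i
          ... | J , settled with V J
          ... | t , J≤t , e with settled t J≤t
          ... | j , i≤j , m with Stage.within (stages j) m
          ...   | inj₁ (le , lt) = j , i≤j , inj₁ (state-at-intro j le lt e)
          ...   | inj₂ sw        = j , i≤j , inj₂ sw
        ... | j , i≤j , s with state-at-elim j s
        ... | p , j≤p , e = p , ℕ.≤-trans i≤j j≤p , e

-- Classically there is none; without Markov's principle this cannot be refuted.
Weird : (ℕ → Bool) → Set
Weird β = ¬ Inf β × ¬ ∃ λ t → ∀ j → t ≤ j → β j ≡ false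

upper-bound : ∀ {n} (t : Fin n → ℕ) → ∃ λ b → ∀ i → t i ≤ b
upper-bound {zero}  t = 0 , λ ()
upper-bound {suc n} t with upper-bound (t ∘ suc)
... | b , le = t zero ⊔ b , λ { zero → ℕ.m≤m⊔n (t zero) b ; (suc i) → ℕ.≤-trans (le i) (ℕ.m≤n⊔m (t zero) b) }

-- A value that does not recur stops occurring, up to double negation, since its occurrences would
-- otherwise form a `Weird` sequence. The value of `f` at a common bound for all values is then
-- impossible.
recurring-value : ∀ {m} (f : ℕ → Fin m) → ¬ (∃ Weird) → ¬ ¬ ∃ λ v → ∀ i → ∃ λ j → i ≤ j × f j ≡ v
recurring-value {m} f no-weird none = ¬¬-all vanishes λ t →
  let b , le = upper-bound (proj₁ ∘ t) in proj₂ (t (f b)) b (le (f b)) refl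
  where
  is : Fin m → ℕ → Bool
  is v j = does (f j Fin.≟ v)
  vanishes : ∀ v → ¬ ¬ ∃ λ t → ∀ j → t ≤ j → f j ≢ v
  vanishes v k = no-weird (is v , (λ inf → none (v , λ i → let j , le , e = inf i in j , le , does-true (f j Fin.≟ v) e)) ,
    λ (t , fin) → k (t , λ j le e → contradiction (trans (sym (dec-true (f j Fin.≟ v) e)) (fin j le)) λ ()))

-- The two cases of the fooling argument

module Core {k m : ℕ} {f₀ : Ranking k} (F₀ : IsQ m f₀) {gs : List (Ranking k)} (Gs : All (IsQ m) gs) where

  open Pump F₀ Gs public

  -- Once r has occurred at the end of a block, a later recharge d exists up to double negation, and
  -- from d on every return to r closes a loop through d. If r never occurs there, nothing is asked.
  -- Finitely many states have a common bound.
  eventual-detours : ∀ {n β} → Weird β → (ρ : ℕ → Fin n) →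
    ¬ ¬ ∃ λ t → ∀ i → t ≤ i → Detour β ρ (ρ (suc i * period))
  eventual-detours {n} {β} (_ , infinite) ρ none = ¬¬-all from-state λ t →
    let b , le = upper-bound (proj₁ ∘ t) in
    none (b , λ i b≤i → proj₂ (t _) i (ℕ.≤-trans (le _) b≤i) refl)
    where
    from-state : ∀ r → ¬ ¬ ∃ λ t → ∀ i → t ≤ i → ρ (suc i * period) ≡ r → Detour β ρ r
    from-state r k = k (0 , λ i _ e → ⊥-elim (infinite (suc i , λ d le → free d le e)))
      where
      free : ∀ {i} d → suc i ≤ d → ρ (suc i * period) ≡ r → β d ≡ false
      free d le e with β d in eq
      ... | false = refl
      ... | true  = ⊥-elim (k (d , λ j d≤j e′ → record
        { a≤d = le ; d<c = s≤s d≤j ; charge = eq ; leave = sym e ; return = e′ }))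

  record Pumps {n} (β : ℕ → Bool) (ρ : ℕ → Fin n) : Set where
    field
      φ       : ℕ → ℕ
      σ       : ℕ → St k
      φ-zero  : φ 0 ≡ 0
      σ-zero  : ∃ λ p → σ 0 ≡ slot p
      jumps   : ∀ j → ρ (suc (φ j)) ≡ ρ (φ (suc j))
      traces  : Traces (letters β ∘ φ) σ
      recurs  : InfOcc σ final
      same    : ∀ q → InfOcc ρ q ⇔ InfOcc (ρ ∘ φ) q

  pump : ∀ {n β} {ρ : ℕ → Fin n} {T₀} (gadgets : ∀ i → ∃ (Gadget β ρ i))
    (sch : Schedule T₀ (proj₁ ∘ gadgets) (state-at β ρ)) →
    (∀ i → Schedule.switch sch i ≡ true → Detour β ρ (ρ (suc i * period))) → Pumps β ρ
  pump {β = β} {ρ} gadgets sch detours = record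
    { φ = φ ; σ = σ ; φ-zero = φ-start ; σ-zero = σ-start ; jumps = ρ-step
    ; traces = σ-traces ; recurs = final-recurs ; same = same-recurring }
    where open Pumped β ρ gadgets sch detours

  -- As the goal is a negation, excluded middle and the double negations of `schedule`,
  -- `eventual-detours` and `recurring-value` can be used freely.
  unpumpable-absurd : ∀ {n} → n < length gs → Incomparable gs →
    ¬ (∀ β → ¬ Inf β → ∃ λ (ρ : ℕ → Fin n) → ¬ Pumps β ρ)
  unpumpable-absurd {zero} n<L inc unpumpable
    with proj₁ (unpumpable (λ _ → false) λ inf → contradiction (proj₂ (proj₂ (inf 0))) λ ()) 0
  ... | ()
  unpumpable-absurd {suc n} n<L inc unpumpable = ¬¬-excluded-middle {A = ∃ Weird} λ
    { (yes (β , weird)) → strange β weird (unpumpable β (proj₁ weird))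
    ; (no no-weird) → tame no-weird (unpumpable (λ _ → false) λ inf → contradiction (proj₂ (proj₂ (inf 0))) λ ()) }
    where
    strange : ∀ β → Weird β → (∃ λ (ρ : ℕ → Fin (suc n)) → ¬ Pumps β ρ) → ⊥
    strange β weird (ρ , np) = eventual-detours weird ρ λ (T₀ , det) →
      schedule T₀ (proj₁ ∘ gadgets) (state-at β ρ) λ sch →
      np (pump gadgets sch λ i sw → det i (Schedule.late sch i sw))
      where gadgets = gadget β ρ n<L inc
    tame : ¬ (∃ Weird) → (∃ λ (ρ : ℕ → Fin (suc n)) → ¬ Pumps (λ _ → false) ρ) → ⊥
    tame no-weird (ρ , np) = recurring-value (proj₁ ∘ gadgets) no-weird λ (v , V) →
      np (pump {T₀ = 0} gadgets (constant v V) λ _ ())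
      where gadgets = gadget (λ _ → false) ρ n<L inc

  module _ (β : ℕ → Bool) (inf : Inf β) (v : Fin m) where

    -- With `id` for ρ no proper jump is possible, so the walk reads the word in its own order.
    open Walks β id

    private
      record Step (i : ℕ) : Set where
        field
          {flag} : Bool
          seg    : Seg (i * period) (suc i * period) (thread v) (thread v) flag
          up     : β i ≡ true → flag ≡ true
      open Step

      step : ∀ i → Step i
      step i with β i in eq
      ... | true  = record { seg = recharge-seg i v v eq ; up = λ _ → refl }
      ... | false = record { seg = proj₂ (stay-seg i v) ; up = λ e → contradiction (trans (sym eq) e) λ () }

      open Concat (λ i → i * period , thread v) (λ i → Seg.list (seg (step i))) (λ i → Seg.chain (seg (step i)))
        (λ i → seg-length (ℕ.m<n+m (i * period) z<s) (seg (step i)))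

      in-order : ∀ j → proj₁ (seq j) ≡ j
      in-order zero    = cong proj₁ seq-start
      in-order (suc j) = trans (sym (proj₁ (seq-edge j))) (cong suc (in-order j))

    charged-run : ∃ λ σ → Traces (letters β) σ × (∃ λ p → σ 0 ≡ slot p) × InfOcc σ final
    charged-run = proj₂ ∘ seq ,
      (λ t → subst (λ n → Edge (letters β n) (proj₂ (seq t)) (proj₂ (seq (suc t)))) (in-order t) (proj₂ (seq-edge t))) ,
      (_ , cong proj₂ seq-start) ,
      λ i → let j , i≤j , e = inf i ; p , m = Seg.hits (seg (step j)) (up (step j) e) ; t , j≤t , e′ = visits m
            in t , ℕ.≤-trans i≤j j≤t , cong proj₂ e′

-- Acceptance

decode : Fin 12 → Letter
decode = Vec.lookup (idle ∷ rotate ∷ rotate⁻ ∷ turn ∷ turn⁻ ∷ kill ∷ copy ∷ swap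
  ∷ dropIn ∷ dropOut ∷ chargeIn ∷ chargeOut ∷ [])

encode : Letter → Fin 12
encode idle      = F.# 0
encode rotate    = F.# 1
encode rotate⁻   = F.# 2
encode turn      = F.# 3
encode turn⁻     = F.# 4
encode kill      = F.# 5
encode copy      = F.# 6
encode swap      = F.# 7
encode dropIn    = F.# 8
encode dropOut   = F.# 9
encode chargeIn  = F.# 10
encode chargeOut = F.# 11

decode-encode : ∀ a → decode (encode a) ≡ a
decode-encode idle      = refl
decode-encode rotate    = refl
decode-encode rotate⁻   = refl
decode-encode turn      = refl
decode-encode turn⁻     = refl
decode-encode kill      = refl
decode-encode copy      = refl
decode-encode swap      = refl
decode-encode dropIn    = refl
decode-encode dropOut   = refl
decode-encode chargeIn  = refl
decode-encode chargeOut = refl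

subsets : ∀ n → List (Subset n)
subsets zero    = [] ∷ []
subsets (suc n) = map (inside ∷_) (subsets n) ++ map (outside ∷_) (subsets n)

∈-subsets : ∀ {n} (F : Subset n) → F ∈ subsets n
∈-subsets []            = here refl
∈-subsets (inside ∷ F)  = ∈-++⁺ˡ (∈-map⁺ (inside ∷_) (∈-subsets F))
∈-subsets (outside ∷ F) = ∈-++⁺ʳ (map (inside ∷_) (subsets _)) (∈-map⁺ (outside ∷_) (∈-subsets F))

-- For Streett the antecedent is a state that all relevant runs visit infinitely often:
-- "some state recurs" could not be proved without Markov's principle.
finalAcc : ∀ T₁ → AccData T₁ (suc (suc (suc k)))
finalAcc buchi    = ⁅ final ⁆
finalAcc genBuchi = ⁅ final ⁆ ∷ []
finalAcc rabin    = (⁅ final ⁆ , ∅) ∷ []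
finalAcc streett  = (⁅ final ⁆ , ⁅ slot zero ⁆) ∷ []
finalAcc muller   = map (inside ∷_) (subsets _)
finalAcc parity   = λ { final → 0 ; (slot _) → 1 }

-- The double negation is due to Muller: the set of all recurring states can be formed only
-- classically.
recurs⇒successful : ∀ T₁ {σ : ℕ → St k} → InfOcc σ final → ¬ ¬ Successful T₁ (finalAcc T₁) σ
recurs⇒successful buchi    V none = none (final , V , x∈⁅x⁆ final)
recurs⇒successful genBuchi V none = none λ { _ (here refl) → final , V , x∈⁅x⁆ final }
recurs⇒successful rabin    V none = none (_ , here refl , (final , V , x∈⁅x⁆ final) , λ (_ , _ , m) → ∉⊥ m)
recurs⇒successful streett  V none = none λ { _ (here refl) _ → final , V , x∈⁅x⁆ final }
recurs⇒successful parity   V none = none (final , V , (0 , refl) , λ _ _ → z≤n)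
recurs⇒successful {k} muller {σ} V none = ¬¬-all (λ q → ¬¬-excluded-middle {A = InfOcc σ q}) λ occ →
  let recurring = λ q → does (occ (slot q)) in
  none (inside ∷ tabulate recurring , ∈-map⁺ (inside ∷_) (∈-subsets _) , λ
    { final    → mk⇔ (λ _ → Vec.here) (λ _ → V)
    ; (slot q) → mk⇔
        (λ inf → Vec.there (Vec.lookup⇒[]= q _ (trans (Vec.lookup∘tabulate recurring q) (dec-true (occ (slot q)) inf))))
        (λ { (Vec.there m) → does-true (occ (slot q)) (trans (sym (Vec.lookup∘tabulate recurring q)) (Vec.[]=⇒lookup m)) }) })

successful⇒recurs : ∀ T₁ {σ : ℕ → St k} → InfOcc σ (slot zero) → Successful T₁ (finalAcc T₁) σ → InfOcc σ final
successful⇒recurs buchi _ (q , V , m) with refl ← x∈⁅y⁆⇒x≡y final m = V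
successful⇒recurs genBuchi _ S with q , V , m ← S _ (here refl) with refl ← x∈⁅y⁆⇒x≡y final m = V
successful⇒recurs rabin _ (_ , here refl , (q , V , m) , _) with refl ← x∈⁅y⁆⇒x≡y final m = V
successful⇒recurs streett V₀ S with q , V , m ← S _ (here refl) (_ , V₀ , x∈⁅x⁆ (slot zero))
  with refl ← x∈⁅y⁆⇒x≡y final m = V
successful⇒recurs muller _ (F , m , V) with F′ , _ , refl ← ∈-map⁻ (inside ∷_) m = Equivalence.from (V final) Vec.here
successful⇒recurs parity _ (final , V , _) = V
successful⇒recurs parity _ (slot _ , _ , (zero , ()) , _)
successful⇒recurs parity _ (slot _ , _ , (suc zero , ()) , _)
successful⇒recurs parity _ (slot _ , _ , (suc (suc h) , ()) , _)

Successful-resp : ∀ T₂ {n} {acc : AccData T₂ n} {ρ ρ′ : ℕ → Fin n} →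
  (∀ q → InfOcc ρ q ⇔ InfOcc ρ′ q) → Successful T₂ acc ρ → Successful T₂ acc ρ′
Successful-resp T₂ {n} {acc} {ρ} {ρ′} same = go T₂
  where
  to = λ q → Equivalence.to (same q)
  from = λ q → Equivalence.from (same q)
  there′ : ∀ {F} → Meets ρ F → Meets ρ′ F
  there′ (q , V , m) = q , to q V , m
  back′ : ∀ {F} → Meets ρ′ F → Meets ρ F
  back′ (q , V , m) = q , from q V , m
  go : ∀ T₂ {acc : AccData T₂ n} → Successful T₂ acc ρ → Successful T₂ acc ρ′
  go buchi    S = there′ S
  go genBuchi S F m = there′ (S F m)
  go rabin    (GB , m , S , ¬S) = GB , m , there′ S , ¬S ∘ back′
  go streett  S GB m = there′ ∘ S GB m ∘ back′
  go muller   (F , m , S) = F , m , λ q → mk⇔ (Equivalence.to (S q) ∘ from q) (to q ∘ Equivalence.from (S q))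
  go parity   (q , V , e , le) = q , to q V , e , λ q′ V′ → le q′ (from q′ V′)

InfOcc-resp : ∀ {n} {ρ ρ′ : ℕ → Fin n} → ρ ≗ ρ′ → ∀ q → InfOcc ρ q → InfOcc ρ′ q
InfOcc-resp e q V i with V i
... | j , le , r = j , le , trans (sym (e j)) r

-- Runs forced upon a complementing or deterministic automaton

module Reduction {T₁ T₂ : AccType} {s : ℕ} (A : Aut T₁ s) (B : Aut T₂ s) where

  -- All that the argument uses of the hypotheses on B in (i) and (ii).
  Trapped : Word s → Set
  Trapped α = ∃ λ ρ → IsRun B α ρ ×
    (∀ α′ ρ′ → IsRun B α′ ρ′ → (∀ q → InfOcc ρ q ⇔ InfOcc ρ′ q) → ¬ Accepts A α′)

  complement-trapped : (∀ α → Accepts B α ⇔ (¬ Accepts A α)) → ∀ α → ¬ Accepts A α → Trapped α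
  complement-trapped C α rej with Equivalence.from (C α) rej
  ... | ρ , R , S = ρ , R , λ α′ ρ′ R′ same → Equivalence.to (C α′) (ρ′ , R′ , Successful-resp T₂ same S)

  module _ (D : Deterministic B) where

    private
      q₀ = proj₁ (proj₁ D)
      functional = proj₂ D

    run : Word s → ℕ → Fin (states B)
    run α zero    = q₀
    run α (suc t) with Fin.any? (λ r → delta B (run α t) (α t) r Bool.≟ true)
    ... | yes (r , _) = r
    -- A dummy value that makes `run` total; `deterministic-trapped` shows that it never arises on
    -- the words in question.
    ... | no _        = run α t

    run-step : ∀ α t r → delta B (run α t) (α t) r ≡ true → run α (suc t) ≡ r
    run-step α t r e with Fin.any? (λ r → delta B (run α t) (α t) r Bool.≟ true)
    ... | yes (r′ , e′) = functional _ _ _ _ e′ e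
    ... | no none       = contradiction (r , e) none

    run-unique : ∀ {α α′ ρ} → IsRun B α′ ρ → ∀ t → (∀ i → i < t → α′ i ≡ α i) → run α t ≡ ρ t
    run-unique (I , _) zero _ = sym (proj₂ (proj₂ (proj₁ D)) _ I)
    run-unique {α} {α′} {ρ} R@(_ , step) (suc t) ag = run-step α t (ρ (suc t))
      (trans (cong₂ (λ p a → delta B p a (ρ (suc t)))
        (run-unique R t λ i lt → ag i (ℕ.m<n⇒m<1+n lt)) (sym (ag t ℕ.≤-refl))) (step t))

    -- By uniqueness of runs, acceptance of a rearranged word makes ρ′ successful, hence also the
    -- run over α, so that `A` would accept α. The words of `approx` show that this run exists: each
    -- of its steps is a step of an accepting run over a word with the same prefix.
    deterministic-trapped : (∀ α → Accepts B α ⇔ Accepts A α) → ∀ α → ¬ Accepts A α →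
      (∀ t → ∃ λ α′ → (∀ i → i < t → α′ i ≡ α i) × ¬ ¬ Accepts A α′) → Trapped α
    deterministic-trapped C α rej approx = run α , isRun , λ α′ ρ′ R′ same acc′ →
      let ρ″ , R″ , S″ = Equivalence.from (C α′) acc′
          ρ″≗ρ′ = λ t → trans (sym (run-unique {α′} R″ t λ _ _ → refl)) (run-unique {α′} R′ t λ _ _ → refl)
      in rej (Equivalence.to (C α) (run α , isRun ,
           Successful-resp T₂ (λ q → mk⇔ (Equivalence.from (same q)) (Equivalence.to (same q)))
             (Successful-resp T₂ (λ q → mk⇔ (InfOcc-resp ρ″≗ρ′ q) (InfOcc-resp (sym ∘ ρ″≗ρ′) q)) S″)))
      where
      isRun : IsRun B α (run α)
      isRun = proj₁ (proj₂ (proj₁ D)) , edge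
        where
        edge : ∀ t → delta B (run α t) (α t) (run α (suc t)) ≡ true
        edge t with delta B (run α t) (α t) (run α (suc t)) Bool.≟ true
        ... | yes e = e
        ... | no ne with approx (suc t)
        ... | α′ , ag , acc = ⊥-elim (acc λ acc′ → let ρ , R , _ = Equivalence.from (C α′) acc′ in
          ne (trans (cong₂ (λ p r → delta B p (α t) r)
                (run-unique R t λ i lt → ag i (ℕ.m<n⇒m<1+n lt)) (run-unique R (suc t) ag))
              (trans (cong (λ a → delta B (ρ t) a (ρ (suc t))) (sym (ag t ℕ.≤-refl))) (proj₂ R t))))

fullAut : ∀ T₁ k → Aut T₁ 12
fullAut T₁ k = record
  { states = suc (suc (suc k))
  ; init   = outside ∷ entire
  ; delta  = λ s a t → does (edge? (decode a) s t)
  ; acc    = finalAcc T₁ }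

-- Enumeration of the Q-rankings and the bound on the states

toRanking : ∀ {b} → Vec (Fin b) (suc (suc k)) → Ranking k
toRanking h p = toℕ (Vec.lookup h p)

-- The enumeration is lexicographic with increasing entries, so the first component in which two
-- vectors differ is a witness.
allVecs-ordered : ∀ a b → AllPairs (λ g h → ∃ λ p → toℕ (Vec.lookup g p) < toℕ (Vec.lookup h p)) (allVecs a b)
allVecs-ordered zero    b = [] ∷ []
allVecs-ordered (suc a) b = AllPairs.concat⁺
  (All.map⁺ (All.tabulate λ {x} _ → AllPairs.map⁺ (AllPairs.map (λ (p , lt) → suc p , lt) (allVecs-ordered a b))))
  (AllPairs.map⁺ (AllPairs.tabulate⁺-< λ {x} {y} x<y → All.map⁺ (All.tabulate λ _ → All.map⁺ (All.tabulate λ _ → zero , x<y))))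

allPairs-lookup : ∀ {A : Set} {R : A → A → Set} {xs} → AllPairs R xs → ∀ i j → i F.< j → R (lookup xs i) (lookup xs j)
allPairs-lookup (r ∷ _)  zero    (suc j) _        = All.lookup r (∈-lookup j)
allPairs-lookup (_ ∷ rs) (suc i) (suc j) (s≤s lt) = allPairs-lookup rs i j lt

any-toList : ∀ {A : Set} {P : A → Set} {n} (v : Vec A n) → Any P (toList v) → ∃ λ i → P (Vec.lookup v i)
any-toList (x ∷ v) (here p) = zero , p
any-toList (x ∷ v) (there a) with any-toList v a
... | i , p = suc i , p

toRanking-IsQ : ∀ m (h : Vec (Fin (2 * m)) (suc (suc k))) → Bool.T (isQRanking m h) → IsQ m (toRanking h)
toRanking-IsQ m h q = isQ (λ p → subst (toRanking h p <_) (cong (m +_) (ℕ.+-identityʳ m)) (Fin.toℕ<n (Vec.lookup h p))) att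
  where
  att : ∀ j → j < m → ∃ λ p → toRanking h p ≡ odd j
  att j j<m with any-toList h (Any.any⁻ _ _ (All.lookup (All.all⁺ _ (upTo m) q) (∈-upTo⁺ j<m)))
  ... | p , e = p , trans (ℕ.≡ᵇ⇒≡ _ _ e)
    (trans (ℕ.+-comm (2 * j) 1) (cong (λ i → suc (j + i)) (ℕ.+-identityʳ j)))

-- `Fin m` expresses that m is positive; its element later serves as the level of a thread in the
-- accepted words.
Ln-least : ∀ n {b} → (∀ m → Fin m → Lnm n m ≤ b) → Ln n ≤ b
Ln-least n {b} le = foldr-preservesᵇ {P = _≤ b} ℕ.⊔-lub z≤n
  (All.map⁺ (All.tabulate {xs = upTo (n ∸ 1)} λ {i} _ → le (suc i) zero))

module _ (T₁ : AccType) (k : ℕ) where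

  private
    A = fullAut T₁ k

    start-slot : ∀ {s : St k} → s ∈ˢ init A → ∃ λ p → s ≡ slot p
    start-slot {slot p} _ = p , refl

    slot-start : ∀ {s : St k} → (∃ λ p → s ≡ slot p) → s ∈ˢ init A
    slot-start (p , refl) = Vec.there ∈⊤

    delta⇒traces : ∀ (w : ℕ → Letter) (σ : ℕ → St k) →
      (∀ t → delta A (σ t) (encode (w t)) (σ (suc t)) ≡ true) → Traces w σ
    delta⇒traces w σ R t = does-true (edge? (w t) (σ t) (σ (suc t)))
      (subst (λ a → does (edge? a (σ t) (σ (suc t))) ≡ true) (decode-encode (w t)) (R t))

    traces⇒delta : ∀ (w : ℕ → Letter) (σ : ℕ → St k) → Traces w σ →
      ∀ t → delta A (σ t) (encode (w t)) (σ (suc t)) ≡ true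
    traces⇒delta w σ R t = subst (λ a → does (edge? a (σ t) (σ (suc t))) ≡ true) (sym (decode-encode (w t)))
      (dec-true (edge? (w t) (σ t) (σ (suc t))) (R t))

    accepts : ∀ (w : ℕ → Letter) (σ : ℕ → St k) → Traces w σ → (∃ λ p → σ 0 ≡ slot p) → InfOcc σ final →
      ¬ ¬ Accepts A (encode ∘ w)
    accepts w σ R σ₀ V none = recurs⇒successful T₁ V λ S →
      none (σ , (slot-start σ₀ , traces⇒delta w σ R) , S)

  no-small-automaton : ∀ {T₂ m} {gs : List (Ranking k)} → Fin m → All (IsQ m) gs → Incomparable gs →
    (B : Aut T₂ 12) →
    (∀ α → ¬ Accepts A α → (∀ t → ∃ λ α′ → (∀ i → i < t → α′ i ≡ α i) × ¬ ¬ Accepts A α′) →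
      Reduction.Trapped A B α) →
    length gs ≤ states B
  no-small-automaton {gs = []} _ _ _ _ _ = z≤n
  no-small-automaton {gs = g ∷ gs} v (G ∷ Gs) inc B trap = ℕ.≮⇒≥ λ n<L → unpumpable-absurd n<L inc unpumpable
    where
    -- Any Q-ranking can serve as the ranking at the block boundaries; the first of the list is
    -- taken.
    open Core G (G ∷ Gs)

    rejects : ∀ β → ¬ Inf β → ¬ Accepts A (encode ∘ letters β)
    rejects β ¬inf (σ , (I , R) , S) =
      ¬inf (final-recurs⇒recharges β σ R′ (start-slot I)
        (successful⇒recurs T₁ (slot-zero-recurs β σ R′ (start-slot I)) S))
      where
      R′ : Traces (letters β) σ
      R′ = delta⇒traces (letters β) σ R

    approximable : ∀ β t → ∃ λ α′ → (∀ i → i < t → α′ i ≡ encode (letters β i)) × ¬ ¬ Accepts A α′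
    approximable β t = encode ∘ letters β′ ,
      (λ i i<t → cong encode (letters-local i λ j j≤i → same j (ℕ.≤-trans j≤i (ℕ.<⇒≤ i<t)))) ,
      (let σ , R , σ₀ , V = charged-run β′ inf v in accepts (letters β′) σ R σ₀ V)
      where
      -- Keeping β up to index t is more than enough, since letter i lies in a block of index at
      -- most i.
      β′ : ℕ → Bool
      β′ i = if does (i ≤? t) then β i else true
      same : ∀ i → i ≤ t → β′ i ≡ β i
      same i le = cong (λ d → if d then β i else true) (dec-true (i ≤? t) le)
      inf : Inf β′
      inf i = suc (i + t) , ℕ.m≤n⇒m≤1+n (ℕ.m≤m+n i t) ,
        cong (λ d → if d then β (suc (i + t)) else true) (dec-false (suc (i + t) ≤? t) (ℕ.<⇒≱ (s≤s (ℕ.m≤n+m t i))))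

    rearranged : ∀ (w : ℕ → Letter) (ρ : ℕ → Fin (states B)) (φ : ℕ → ℕ) → φ 0 ≡ 0 →
      (∀ j → ρ (suc (φ j)) ≡ ρ (φ (suc j))) → IsRun B (encode ∘ w) ρ → IsRun B (encode ∘ w ∘ φ) (ρ ∘ φ)
    rearranged w ρ φ z jumps (I , R) = subst (λ i → ρ i ∈ˢ init B) (sym z) I ,
      λ j → subst (λ r → delta B (ρ (φ j)) (encode (w (φ j))) r ≡ true) (jumps j) (R (φ j))

    trapped⇒unpumpable : ∀ β → Reduction.Trapped A B (encode ∘ letters β) →
      ∃ λ (ρ : ℕ → Fin (states B)) → ¬ Pumps β ρ
    trapped⇒unpumpable β (ρ , R , stuck) = ρ , λ (pumps : Pumps β ρ) →
      accepts (letters β ∘ Pumps.φ pumps) (Pumps.σ pumps) (Pumps.traces pumps) (Pumps.σ-zero pumps) (Pumps.recurs pumps)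
        (stuck (encode ∘ letters β ∘ Pumps.φ pumps) (ρ ∘ Pumps.φ pumps)
          (rearranged (letters β) ρ (Pumps.φ pumps) (Pumps.φ-zero pumps) (Pumps.jumps pumps) R)
          (Pumps.same pumps))

    unpumpable : ∀ β → ¬ Inf β → ∃ λ (ρ : ℕ → Fin (states B)) → ¬ Pumps β ρ
    unpumpable β ¬inf = trapped⇒unpumpable β
      (trap (encode ∘ letters β) (rejects β ¬inf) (approximable β))

  Ln≤ : ∀ {T₂} (B : Aut T₂ 12) →
    (∀ α → ¬ Accepts A α → (∀ t → ∃ λ α′ → (∀ i → i < t → α′ i ≡ α i) × ¬ ¬ Accepts A α′) →
      Reduction.Trapped A B α) →
    Ln (3 + k) ≤ states B
  Ln≤ B trap = Ln-least (3 + k) Lnm≤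
    where
    Lnm≤ : ∀ m → Fin m → Lnm (3 + k) m ≤ states B
    Lnm≤ m v = subst (_≤ states B) (length-map toRanking rankings) (no-small-automaton v
      (All.map⁺ (All.map (λ {h} → toRanking-IsQ m h) (All.all-filter (T? ∘ isQRanking m) (allVecs (2 + k) (2 * m)))))
      (allPairs-lookup ordered) B trap)
      where
      rankings = filterᵇ (isQRanking m) (allVecs (2 + k) (2 * m))
      ordered : AllPairs (λ (g h : Ranking k) → ∃ λ p → g p < h p) (map toRanking rankings)
      ordered = AllPairs.map⁺ (AllPairs.filter⁺ (T? ∘ isQRanking m) (allVecs-ordered (2 + k) (2 * m)))

-- L(2) = 1 only asks for an automaton with a rejected word.
trivialAut : ∀ T₁ → Aut T₁ 1
trivialAut T₁ = record { states = 2 ; init = ∅ ; delta = λ _ _ _ → false ; acc = acc₀ T₁ }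
  where
  acc₀ : ∀ T₁ → AccData T₁ 2
  acc₀ buchi    = ∅
  acc₀ genBuchi = []
  acc₀ rabin    = []
  acc₀ streett  = []
  acc₀ muller   = []
  acc₀ parity   = λ _ → 0

inhabited : ∀ {n} → Fin n → 1 ≤ n
inhabited {suc _} _ = s≤s z≤n

theorem4p10 : ∃ λ (c : ℕ) → ∀ (n : ℕ) → 2 ≤ n → (T₁ : AccType) →
    ∃ λ (s : ℕ) → s ≤ c × Σ (Aut T₁ s) λ A → states A ≡ n ×
    ((T₂ : AccType) (B : Aut T₂ s) →
    (∀ α → Accepts B α ⇔ (¬ Accepts A α)) → Ln n ≤ states B) ×
    ((T₂ : AccType) → NotBuchiLike T₂ → (B : Aut T₂ s) → Deterministic B →
    (∀ α → Accepts B α ⇔ Accepts A α) → Ln n ≤ states B)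
theorem4p10 = 12 , bound
  where
  bound : ∀ n → 2 ≤ n → ∀ T₁ → _
  bound (suc zero) (s≤s ()) _
  bound (suc (suc zero)) _ T₁ = 1 , s≤s z≤n , trivialAut T₁ , refl ,
    (λ _ B C → inhabited (proj₁ (Equivalence.from (C (λ _ → zero)) λ (_ , (I , _) , _) → ∉⊥ I) 0)) ,
    (λ _ _ B D _ → inhabited (proj₁ (proj₁ D)))
  bound (suc (suc (suc k))) _ T₁ = 12 , ℕ.≤-refl , A , refl ,
    (λ _ B C → Ln≤ T₁ k B λ α rej _ → Reduction.complement-trapped A B C α rej) ,
    (λ _ _ B D C → Ln≤ T₁ k B λ α rej approx → Reduction.deterministic-trapped A B D C α rej approx)
    where A = fullAut T₁ k
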